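{- Let $G=(V,E)$ be an undirected graph with $n=|V|$ vertices and $m=|E|$ edges, and let $\bar\delta$ be its average degeneracy. Counting the 4-cycles of $G$ (that is, computing the number $\square(G)$ of distinct 4-cycles in $G$) takes $O(m\bar\delta)$ time and $n$ space; i.e. there is an algorithm which, given any such $G$, computes $\square(G)$ within these bounds.
   Context: Graphs are finite, simple and undirected, with vertices labeled by $[n]=\{1,\dots,n\}$; $N(v)=\{u: uv\in E\}$ and $d(v)=|N(v)|$. The average degeneracy is $\bar\delta=\frac1m\sum_{uv\in E}\min\{d(u),d(v)\}$. A 4-cycle ($C_4$) is a sequence of four distinct vertices $x,y,z,w$ with $xy,yz,zw,wx\in E$; the eight sequences obtained from it by cyclic shifts and reversal count as a single distinct 4-cycle. $\square(G)$ denotes the number of distinct 4-cycles in $G$. Computational model: the input graph is given in adjacency-list form, with an arbitrary ordering of the neighbors of each vertex; vertex degrees can be looked up in constant time; array access, comparison and addition on words take constant time. Time bounds are worst-case bounds for deterministic algorithms (no hashing or randomness). Space is measured in words and does not include the storage of the input graph; "$n$ space" means an array of precisely $n$ words, not counting the constantly many scalar variables (loop variables and the output counter). -}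

module Defs where

open import Data.Bool.Base using (Bool; true; false)
open import Data.Fin.Base using (Fin; toℕ) renaming (_<_ to _<ᶠ_)
open import Data.Fin.Properties using (toℕ-injective) renaming (_≟_ to _≟ᶠ_; _<?_ to _<ᶠ?_)
import Data.Integer.Base as ℤ
open import Data.List.Base using (List; []; _∷_; _++_; length; map; filter; take; concatMap; allFin; cartesianProduct; deduplicate)
import Data.List.Membership.DecPropositional as DecMembership
open import Data.List.Membership.Propositional using (_∈_)
open import Data.List.Relation.Binary.Permutation.Propositional using (_↭_)
open import Data.List.Relation.Unary.Unique.Propositional using (Unique)
import Data.List.Relation.Unary.Unique.DecPropositional as DecUnique
open import Data.Nat.Base using (ℕ; zero; suc; _+_; _^_; _<_; _⊓_; _<ᵇ_; _≡ᵇ_)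
open import Data.Nat.ListAction using (sum)
open import Data.Product.Base using (_×_; _,_)
open import Data.Product.Properties using (≡-dec)
open import Data.Rational.Base as ℚ using (ℚ; 0ℚ)
open import Data.Vec.Base using (Vec; lookup; tabulate; fromList; _[_]≔_)
open import Data.Vec.Relation.Unary.All using (All)
open import Level using (0ℓ)
open import Relation.Binary.Core using (Rel)
open import Relation.Binary.Definitions using (Symmetric; Irreflexive; Decidable; DecidableEquality)
open import Relation.Binary.PropositionalEquality using (_≡_; refl; sym; trans)
open import Relation.Nullary.Decidable using (Dec; _×-dec_)

------------------------------------------------------------------------
-- Graphs

record Graph (n : ℕ) : Set₁ where
  field
    _~_      : Rel (Fin n) 0ℓ
    ~-sym    : Symmetric _~_
    ~-irrefl : Irreflexive _≡_ _~_
    _~?_     : Decidable _~_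

module _ {n : ℕ} (G : Graph n) where
  open Graph G

  N : Fin n → List (Fin n)
  N v = filter (v ~?_) (allFin n)

  deg : Fin n → ℕ
  deg v = length (N v)

  IsEdge : Fin n × Fin n → Set
  IsEdge (u , v) = u <ᶠ v × u ~ v

  isEdge? : ∀ e → Dec (IsEdge e)
  isEdge? (u , v) = (u <ᶠ? v) ×-dec (u ~? v)

  -- Each undirected edge uv is listed once, as the pair with u < v.
  edges : List (Fin n × Fin n)
  edges = filter isEdge? (cartesianProduct (allFin n) (allFin n))

  ∣E∣ : ℕ
  ∣E∣ = length edges

  minDegree : Fin n × Fin n → ℕ
  minDegree (u , v) = deg u ⊓ deg v

-- s / m, with the convention that an empty average is 0.
average : (m s : ℕ) → ℚ
average zero      s = 0ℚ
average m@(suc _) s = ℤ.+ s ℚ./ m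

fromℕ : ℕ → ℚ
fromℕ k = ℤ.+ k ℚ./ 1

δ̄ : ∀ {n} → Graph n → ℚ
δ̄ G = average (∣E∣ G) (sum (map (minDegree G) (edges G)))

------------------------------------------------------------------------
-- 4-cycles

Quad : ℕ → Set
Quad n = Fin n × Fin n × Fin n × Fin n

module _ {n : ℕ} where

  _≟Q_ : DecidableEquality (Quad n)
  _≟Q_ = ≡-dec _≟ᶠ_ (≡-dec _≟ᶠ_ (≡-dec _≟ᶠ_ _≟ᶠ_))

  shift reversal : Quad n → Quad n
  shift    (x , y , z , w) = y , z , w , x
  reversal (x , y , z , w) = w , z , y , x

  shifts : Quad n → List (Quad n)
  shifts q = q ∷ shift q ∷ shift (shift q) ∷ shift (shift (shift q)) ∷ []

  _≈_ : Rel (Quad n) 0ℓ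
  q ≈ q′ = q′ ∈ shifts q ++ shifts (reversal q)

  _≈?_ : Decidable _≈_
  q ≈? q′ = DecMembership._∈?_ _≟Q_ q′ (shifts q ++ shifts (reversal q))

module _ {n : ℕ} (G : Graph n) where
  open Graph G

  IsC4 : Quad n → Set
  IsC4 (x , y , z , w) =
    Unique (x ∷ y ∷ z ∷ w ∷ []) × x ~ y × y ~ z × z ~ w × w ~ x

  isC4? : ∀ q → Dec (IsC4 q)
  isC4? (x , y , z , w) =
    DecUnique.unique? _≟ᶠ_ (x ∷ y ∷ z ∷ w ∷ []) ×-dec
    (x ~? y) ×-dec (y ~? z) ×-dec (z ~? w) ×-dec (w ~? x)

  quads : List (Quad n)
  quads = cartesianProduct V (cartesianProduct V (cartesianProduct V V))
    where V = allFin n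

  □ : ℕ
  □ = length (deduplicate _≈?_ (filter isC4? quads))

------------------------------------------------------------------------
-- Input in adjacency-list form

-- The neighbours of each vertex, in an arbitrary order.
record AdjacencyLists {n : ℕ} (G : Graph n) : Set where
  field
    nbrs   : Fin n → List (Fin n)
    nbrs-↭ : ∀ v → nbrs v ↭ N G v

-- Read-only input of a program.  The adjacency lists are stored one after
-- the other in `table`; that of vertex v occupies the positions
-- start v , … , start v + degree v - 1.  Vertices are numbered from 0.
record Input (n : ℕ) : Set where
  field
    size         : ℕ
    degree start : Vec ℕ n
    table        : Vec ℕ size

encode : ∀ {n} {G : Graph n} → AdjacencyLists G → Input n
encode {n} {G} A = record
  { size   = length entries
  ; degree = tabulate (deg G)
  ; start  = tabulate λ v → length (concatMap nbrs (take (toℕ v) (allFin n)))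
  ; table  = fromList entries
  }
  where
  open AdjacencyLists A
  entries : List ℕ
  entries = map toℕ (concatMap nbrs (allFin n))

------------------------------------------------------------------------
-- Programs over r scalar variables and one work array

infix  6 _⊕_
infix  5 _≔_ work[_]≔_
infixr 4 _⨾_

data Operand (r : ℕ) : Set where
  var        : Fin r → Operand r
  lit        : ℕ → Operand r
  order size : Operand r            -- n and the length of `table`

data Array : Set where
  work degree start table : Array

data Expr (r : ℕ) : Set where
  val  : Operand r → Expr r
  _⊕_  : Operand r → Operand r → Expr r
  read : Array → Operand r → Expr r

data Test (r : ℕ) : Set where
  _<ᵗ_ _=ᵗ_ : Operand r → Operand r → Test r

data Comm (r : ℕ) : Set where
  skip      : Comm r
  _≔_       : Fin r → Expr r → Comm r
  work[_]≔_ : Operand r → Operand r → Comm r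
  _⨾_       : Comm r → Comm r → Comm r
  cond      : Test r → Comm r → Comm r → Comm r
  while     : Test r → Comm r → Comm r

record Program : Set where
  field
    scalars : ℕ
    output  : Fin scalars
    body    : Comm scalars

------------------------------------------------------------------------
-- Cost semantics

record State (r n : ℕ) : Set where
  constructor ⟨_,_⟩
  field
    vars  : Vec ℕ r
    array : Vec ℕ n

open State public

-- All values held in the state are words, i.e. smaller than W.
Fits : ∀ {r n} → ℕ → State r n → Set
Fits W s = All (_< W) (vars s) × All (_< W) (array s)

module _ {r n : ℕ} (I : Input n) where

  extent : Array → ℕ
  extent work   = n
  extent degree = n
  extent start  = n
  extent table  = Input.size I

  contents : (A : Array) → State r n → Vec ℕ (extent A)
  contents work   s = array s
  contents degree s = Input.degree I
  contents start  s = Input.start I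
  contents table  s = Input.table I

  ⟦_⟧ : Operand r → State r n → ℕ
  ⟦ var x ⟧ s = lookup (vars s) x
  ⟦ lit k ⟧ s = k
  ⟦ order ⟧ s = n
  ⟦ size  ⟧ s = Input.size I

  ⟦_⟧ᵗ : Test r → State r n → Bool
  ⟦ a <ᵗ b ⟧ᵗ s = ⟦ a ⟧ s <ᵇ ⟦ b ⟧ s
  ⟦ a =ᵗ b ⟧ᵗ s = ⟦ a ⟧ s ≡ᵇ ⟦ b ⟧ s

  -- There is no rule for reading outside an array.
  data Eval (s : State r n) : Expr r → ℕ → Set where
    val  : ∀ {a} → Eval s (val a) (⟦ a ⟧ s)
    add  : ∀ {a b} → Eval s (a ⊕ b) (⟦ a ⟧ s + ⟦ b ⟧ s)
    read : ∀ {A a} (i : Fin (extent A)) → ⟦ a ⟧ s ≡ toℕ i →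
           Eval s (read A a) (lookup (contents A s) i)

  -- Run W c s t s′ : started in s, the command c halts in s′ after t steps,
  -- having stored only values smaller than W.  A run that would overflow a
  -- word or leave an array is stuck, hence not derivable.
  data Run (W : ℕ) : Comm r → State r n → ℕ → State r n → Set where
    skip        : ∀ {s} → Run W skip s 1 s
    assign      : ∀ {s x e v} → Eval s e v → v < W →
                  Run W (x ≔ e) s 1 ⟨ vars s [ x ]≔ v , array s ⟩
    store       : ∀ {s a b} (i : Fin n) → ⟦ a ⟧ s ≡ toℕ i → ⟦ b ⟧ s < W →
                  Run W (work[ a ]≔ b) s 1 ⟨ vars s , array s [ i ]≔ ⟦ b ⟧ s ⟩
    seq         : ∀ {c₁ c₂ s s₁ s₂ t₁ t₂} →
                  Run W c₁ s t₁ s₁ → Run W c₂ s₁ t₂ s₂ →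
                  Run W (c₁ ⨾ c₂) s (t₁ + t₂) s₂
    cond-true   : ∀ {b c₁ c₂ s s′ t} → ⟦ b ⟧ᵗ s ≡ true →
                  Run W c₁ s t s′ → Run W (cond b c₁ c₂) s (1 + t) s′
    cond-false  : ∀ {b c₁ c₂ s s′ t} → ⟦ b ⟧ᵗ s ≡ false →
                  Run W c₂ s t s′ → Run W (cond b c₁ c₂) s (1 + t) s′
    while-true  : ∀ {b c s s₁ s₂ t₁ t₂} → ⟦ b ⟧ᵗ s ≡ true →
                  Run W c s t₁ s₁ → Run W (while b c) s₁ t₂ s₂ →
                  Run W (while b c) s (1 + t₁ + t₂) s₂
    while-false : ∀ {b c s} → ⟦ b ⟧ᵗ s ≡ false → Run W (while b c) s 1 s

  Eval-deterministic : ∀ {s e v v′} → Eval s e v → Eval s e v′ → v ≡ v′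
  Eval-deterministic val val = refl
  Eval-deterministic add add = refl
  Eval-deterministic (read i p) (read j q)
    with refl ← toℕ-injective (trans (sym p) q) = refl

  private
    absurd : ∀ {b} {X : Set} → b ≡ true → b ≡ false → X
    absurd refl ()

  Run-deterministic : ∀ {W c s t t′ s₁ s₂} →
    Run W c s t s₁ → Run W c s t′ s₂ → t ≡ t′ × s₁ ≡ s₂
  Run-deterministic skip skip = refl , refl
  Run-deterministic (assign p _) (assign q _)
    with refl ← Eval-deterministic p q = refl , refl
  Run-deterministic (store i p _) (store j q _)
    with refl ← toℕ-injective (trans (sym p) q) = refl , refl
  Run-deterministic (seq p₁ p₂) (seq q₁ q₂)
    with refl , refl ← Run-deterministic p₁ q₁
    with refl , refl ← Run-deterministic p₂ q₂ = refl , refl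
  Run-deterministic (cond-true _ p) (cond-true _ q)
    with refl , refl ← Run-deterministic p q = refl , refl
  Run-deterministic (cond-true b _) (cond-false b′ _) = absurd b b′
  Run-deterministic (cond-false b _) (cond-true b′ _) = absurd b′ b
  Run-deterministic (cond-false _ p) (cond-false _ q)
    with refl , refl ← Run-deterministic p q = refl , refl
  Run-deterministic (while-true _ p₁ p₂) (while-true _ q₁ q₂)
    with refl , refl ← Run-deterministic p₁ q₁
    with refl , refl ← Run-deterministic p₂ q₂ = refl , refl
  Run-deterministic (while-true b _ _) (while-false b′) = absurd b b′
  Run-deterministic (while-false b) (while-true b′ _ _) = absurd b′ b
  Run-deterministic (while-false _) (while-false _) = refl , refl

-- Words of O(log n) bits; 2 + n rather than n so that they are nontrivial
-- also for n ≤ 1.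
wordBound : (k n : ℕ) → ℕ
wordBound k n = (2 + n) ^ k

{-# OPTIONS --safe #-}

-- Order the vertices by (degree, index), and write u ≺ v for this order.  A 4-cycle has a unique
-- largest vertex v; if u, u′ are its neighbours on the cycle and y is the opposite vertex, then the
-- cycle is an unordered pair of paths v u y, v u′ y with u, u′, y ≺ v.  So for each v it suffices to
-- run through the multiset of ends y ≺ v of such paths, keep in work[y] the number of times y has
-- been met, and add up these numbers.  Finding the paths costs deg u for every edge uv with u ≺ v,
-- which is min(deg u, deg v).
--
-- The time bound leaves no room for a scan of all n vertices, as most of them may be isolated.  The
-- program scans the table of adjacency lists instead, and handles an entry v exactly when it lies in
-- the list of the first neighbour of v; this happens once for every vertex that has neighbours.
-- Clearing work[y] by a preliminary pass over the same paths likewise avoids clearing all of work.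

module Submission where

open import Defs
open import Data.Nat.Base using (ℕ)
open import Data.Product.Base using (Σ-syntax; ∃-syntax; _×_)
open import Data.Vec.Base using (lookup)
open import Relation.Binary.PropositionalEquality using (_≡_)

import Data.Nat.Properties as ℕ
open import Data.List.Base using (List; []; _∷_; length)
open import Data.Nat.Base using (zero; suc; _+_)
open import Data.Nat.Tactic.RingSolver using (solve-∀)
open import Data.Product.Base using (_,_)
open import Relation.Binary.PropositionalEquality as ≡ using (cong; sym)
open import Relation.Nullary.Negation using (contradiction)

-- The number credited to `v` is the number of pairs of equal entries, at different positions, in
-- the list of ends met from `v`: adding a counter before incrementing it adds one for each earlier
-- occurrence. The combinatorial side is therefore a theory of sums over pairs of positions. Two
-- ends met through the same `u` never agree, and those met through `u` and `u′` agree once per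
-- common neighbour, so no degenerate closed walk is counted. Such sums are invariant under
-- permutation, which removes the arbitrary order of the neighbours.
--
-- The semantics turns an overflow or a bad index into a stuck run, so every addition needs its
-- bound in advance, although `work` starts with arbitrary contents. The loop invariants therefore
-- refer to the outcome: what is stored together with what is still to come gives a fixed result,
-- and `□ G`, at most the fourth power of n, bounds every partial count.
--
-- Visiting the table costs a constant for each of the 2m arcs. As both ends of an edge have degree
-- at least 1, the sum of the minimum degrees absorbs this. The maximum with 1 in the bound pays for
-- the start-up cost on an edgeless graph.

module _ where

  open import Data.Fin.Base using (Fin; zero; suc; toℕ; fromℕ<) renaming (_<_ to _<ᶠ_)
  open import Data.Fin.Patterns using (0F; 1F; 2F; 3F; 4F; 5F; 6F; 7F; 8F; 9F)
  open import Data.Fin.Properties using (toℕ<n; toℕ-fromℕ<; toℕ-injective)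
    renaming (_≟_ to _≟ᶠ_; _<?_ to _<ᶠ?_; <-trans to <ᶠ-trans; <-irrefl to <ᶠ-irrefl;
              <-cmp to <ᶠ-cmp; <-asym to <ᶠ-asym; <⇒≢ to <ᶠ⇒≢)
  open import Data.List.Base 
    using (_++_; _∷ʳ_; map; filter; concatMap; allFin; cartesianProduct; deduplicate; take; drop)
  open import Data.List.Membership.Propositional using (_∈_; lose; find)
  open import Data.List.Membership.Propositional.Properties
    using (∈-allFin; ∈-∃++; ∈-++⁻; ∈-++⁺ˡ; ∈-++⁺ʳ; ∈-filter⁺; ∈-filter⁻; ∈-cartesianProduct⁺; ∈-length)
  open import Data.List.Properties
    using (map-++; map-∘; map-cong; length-map; length-++; length-tabulate; length-filter;
           filter-accept; filter-reject; concatMap-++; ++-assoc; ++-identityʳ; ++-identityʳ-unique;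
           ++-cancelˡ; take++drop≡id; take-suc-tabulate; take-all)
  open import Data.List.Relation.Binary.Permutation.Propositional using (_↭_; refl; prep; swap; trans; ↭-sym)
  open import Data.List.Relation.Binary.Permutation.Propositional.Properties
    using (map⁺; filter-↭; ∈-resp-↭; ↭-length)
  open import Data.List.Relation.Unary.All as All using (All; []; _∷_)
  open import Data.List.Relation.Unary.All.Properties using (all-filter)
  open import Data.List.Relation.Unary.AllPairs as AllPairs using (AllPairs; []; _∷_)
  import Data.List.Relation.Unary.AllPairs.Properties as AllPairsₚ
  open import Data.List.Relation.Unary.Any using (here; there)
  import Data.List.Relation.Unary.Any.Properties as Anyₚ
  open import Data.List.Relation.Unary.Unique.Propositional using (Unique)
  open import Data.List.Relation.Unary.Unique.Propositional.Properties using (allFin⁺; cartesianProduct⁺; filter⁺)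
  open import Data.Nat.Base as ℕᵇ using (_*_; _^_; _⊓_; _≤_; _<_; _<ᵇ_; _≡ᵇ_; z≤n; s≤s)
  open import Data.Nat.ListAction using (sum)
  open import Data.Nat.ListAction.Properties using (sum-++; sum-↭)
  open import Data.Bool.Base using (true; false; if_then_else_)
  open import Data.Product.Base using (proj₁; proj₂)
  open import Data.Sum.Base using (_⊎_; inj₁; inj₂)
  open import Data.Unit.Base using (⊤; tt)
  open import Data.Vec.Base using (Vec; []; _∷_; fromList; _[_]≔_)
  open import Data.Vec.Properties using (lookup∘tabulate; lookup∘update; lookup∘update′)
  open import Function.Base using (_∘_; id)
  open import Level using (0ℓ)
  open import Relation.Binary.Core using (Rel)
  open import Relation.Binary.Definitions using (tri<; tri≈; tri>; Transitive; Decidable)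
  open import Relation.Binary.PropositionalEquality using (_≢_; cong₂; subst; subst₂; ≢-sym; module ≡-Reasoning)
  open import Relation.Nullary using (¬_)
  open import Relation.Nullary.Decidable using (Dec; yes; no; does; dec-true; dec-false; _×-dec_; _⊎-dec_; ¬?)
  import Relation.Unary as Unary

  private
    variable
      A B : Set
      P Q : Set
      n : ℕ

  -- Finite sums, and sums over pairs of positions

  𝟙 : Dec P → ℕ
  𝟙 p? = if does p? then 1 else 0

  𝟙-yes : (p? : Dec P) → P → 𝟙 p? ≡ 1
  𝟙-yes (yes _) _ = ≡.refl
  𝟙-yes (no ¬p) p = contradiction p ¬p

  𝟙-no : (p? : Dec P) → ¬ P → 𝟙 p? ≡ 0
  𝟙-no (yes p) ¬p = contradiction p ¬p
  𝟙-no (no _) _ = ≡.refl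

  𝟙≤1 : (p? : Dec P) → 𝟙 p? ≤ 1
  𝟙≤1 (yes _) = s≤s z≤n
  𝟙≤1 (no _)  = z≤n

  𝟙-⇔ : (p? : Dec P) (q? : Dec Q) → (P → Q) → (Q → P) → 𝟙 p? ≡ 𝟙 q?
  𝟙-⇔ (yes p) q? f g = sym (𝟙-yes q? (f p))
  𝟙-⇔ (no ¬p) q? f g = sym (𝟙-no q? (¬p ∘ g))

  𝟙-× : (p? : Dec P) (q? : Dec Q) → 𝟙 (p? ×-dec q?) ≡ 𝟙 p? * 𝟙 q?
  𝟙-× (yes _) (yes _) = ≡.refl
  𝟙-× (yes _) (no _)  = ≡.refl
  𝟙-× (no _)  q?      = ≡.refl

  ∑ : List A → (A → ℕ) → ℕ
  ∑ xs f = sum (map f xs)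

  ∑-cong : (xs : List A) {f g : A → ℕ} → (∀ x → x ∈ xs → f x ≡ g x) → ∑ xs f ≡ ∑ xs g
  ∑-cong []       f≡g = ≡.refl
  ∑-cong (x ∷ xs) f≡g = cong₂ _+_ (f≡g x (here ≡.refl)) (∑-cong xs λ y → f≡g y ∘ there)

  ∑-cong′ : (xs : List A) {f g : A → ℕ} → (∀ x → f x ≡ g x) → ∑ xs f ≡ ∑ xs g
  ∑-cong′ xs f≡g = cong sum (map-cong f≡g xs)

  ∑-mono-≤ : (xs : List A) {f g : A → ℕ} → (∀ x → x ∈ xs → f x ≤ g x) → ∑ xs f ≤ ∑ xs g
  ∑-mono-≤ []       f≤g = z≤n
  ∑-mono-≤ (x ∷ xs) f≤g = ℕ.+-mono-≤ (f≤g x (here ≡.refl)) (∑-mono-≤ xs λ y → f≤g y ∘ there)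

  ∑-++ : (xs ys : List A) (f : A → ℕ) → ∑ (xs ++ ys) f ≡ ∑ xs f + ∑ ys f
  ∑-++ xs ys f rewrite map-++ f xs ys = sum-++ (map f xs) (map f ys)

  ∑-map : (h : A → B) (xs : List A) (f : B → ℕ) → ∑ (map h xs) f ≡ ∑ xs (f ∘ h)
  ∑-map h xs f = cong sum (sym (map-∘ xs))

  ∑-concatMap : (F : A → List B) (xs : List A) (f : B → ℕ) →
                ∑ (concatMap F xs) f ≡ ∑ xs (λ x → ∑ (F x) f)
  ∑-concatMap F []       f = ≡.refl
  ∑-concatMap F (x ∷ xs) f = ≡.trans (∑-++ (F x) _ f) (cong (∑ (F x) f +_) (∑-concatMap F xs f))

  ∑-cartesianProduct : (xs : List A) (ys : List B) (f : A × B → ℕ) →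
                       ∑ (cartesianProduct xs ys) f ≡ ∑ xs (λ x → ∑ ys (λ y → f (x , y)))
  ∑-cartesianProduct []       ys f = ≡.refl
  ∑-cartesianProduct (x ∷ xs) ys f =
    ≡.trans (∑-++ (map (x ,_) ys) _ f) (cong₂ _+_ (∑-map (x ,_) ys f) (∑-cartesianProduct xs ys f))

  ∑-0 : (xs : List A) → ∑ xs (λ _ → 0) ≡ 0
  ∑-0 []       = ≡.refl
  ∑-0 (_ ∷ xs) = ∑-0 xs

  ∑-const : (xs : List A) (c : ℕ) → ∑ xs (λ _ → c) ≡ length xs * c
  ∑-const []       c = ≡.refl
  ∑-const (_ ∷ xs) c = cong (c +_) (∑-const xs c)

  ∑-+ : (xs : List A) (f g : A → ℕ) → ∑ xs (λ x → f x + g x) ≡ ∑ xs f + ∑ xs g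
  ∑-+ []       f g = ≡.refl
  ∑-+ (x ∷ xs) f g rewrite ∑-+ xs f g = interchange (f x) (g x) (∑ xs f) (∑ xs g)
    where
    interchange : ∀ a b c d → a + b + (c + d) ≡ a + c + (b + d)
    interchange = solve-∀

  ∑-*ˡ : (xs : List A) (c : ℕ) (f : A → ℕ) → ∑ xs (λ x → c * f x) ≡ c * ∑ xs f
  ∑-*ˡ []       c f = sym (ℕ.*-zeroʳ c)
  ∑-*ˡ (x ∷ xs) c f rewrite ∑-*ˡ xs c f = sym (ℕ.*-distribˡ-+ c (f x) (∑ xs f))

  ∑-swap : (xs : List A) (ys : List B) (f : A → B → ℕ) →
           ∑ xs (λ x → ∑ ys (f x)) ≡ ∑ ys (λ y → ∑ xs (λ x → f x y))
  ∑-swap []       ys f = sym (∑-0 ys)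
  ∑-swap (x ∷ xs) ys f rewrite ∑-swap xs ys f = sym (∑-+ ys (f x) (λ y → ∑ xs (λ x → f x y)))

  ∑-↭ : {xs ys : List A} (f : A → ℕ) → xs ↭ ys → ∑ xs f ≡ ∑ ys f
  ∑-↭ f = sum-↭ ∘ map⁺ f

  ∑-filter : {R : A → Set} (R? : Unary.Decidable R) (xs : List A) (f : A → ℕ) →
             ∑ (filter R? xs) f ≡ ∑ xs (λ x → 𝟙 (R? x) * f x)
  ∑-filter R? []       f = ≡.refl
  ∑-filter R? (x ∷ xs) f with R? x
  ... | yes _ = cong₂ _+_ (sym (ℕ.+-identityʳ (f x))) (∑-filter R? xs f)
  ... | no _  = ∑-filter R? xs f

  length-∑ : (xs : List A) → length xs ≡ ∑ xs (λ _ → 1)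
  length-∑ []       = ≡.refl
  length-∑ (_ ∷ xs) = cong suc (length-∑ xs)

  length-filter-∑ : {R : A → Set} (R? : Unary.Decidable R) (xs : List A) →
                    length (filter R? xs) ≡ ∑ xs (𝟙 ∘ R?)
  length-filter-∑ R? xs =
    ≡.trans (length-∑ (filter R? xs))
      (≡.trans (∑-filter R? xs _) (∑-cong′ xs λ x → ℕ.*-identityʳ (𝟙 (R? x))))

  ∑-δ-∉ : {x : Fin n} {xs : List (Fin n)} (f : Fin n → ℕ) → All (x ≢_) xs →
          ∑ xs (λ y → 𝟙 (x ≟ᶠ y) * f y) ≡ 0
  ∑-δ-∉ f [] = ≡.refl
  ∑-δ-∉ {x = x} f (_∷_ {y} x≢y x∉) = cong₂ _+_ (cong (_* f y) (𝟙-no (x ≟ᶠ y) x≢y)) (∑-δ-∉ f x∉)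

  ∑-δ : {x : Fin n} {xs : List (Fin n)} (f : Fin n → ℕ) → Unique xs → x ∈ xs →
        ∑ xs (λ y → 𝟙 (x ≟ᶠ y) * f y) ≡ f x
  ∑-δ {x = x} f (x∉ ∷ _) (here ≡.refl)
    rewrite 𝟙-yes (x ≟ᶠ x) ≡.refl | ∑-δ-∉ f x∉ = ≡.trans (ℕ.+-identityʳ _) (ℕ.+-identityʳ _)
  ∑-δ {x = x} f (_∷_ {y} y∉ uniq) (there x∈)
    rewrite 𝟙-no (x ≟ᶠ y) (All.lookup y∉ x∈ ∘ sym) = ∑-δ f uniq x∈

  ∑-δ-allFin : (x : Fin n) (f : Fin n → ℕ) → ∑ (allFin n) (λ y → 𝟙 (x ≟ᶠ y) * f y) ≡ f x
  ∑-δ-allFin x f = ∑-δ f (allFin⁺ _) (∈-allFin x)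

  -- Pairs of positions, not of values: with Kronecker's delta for `f` this counts the coincidences
  -- in a list, which is what a row of counters adds up.
  pairs : (A → A → ℕ) → List A → ℕ
  pairs f []       = 0
  pairs f (x ∷ xs) = ∑ xs (f x) + pairs f xs

  pairs-cong : {f g : A → A → ℕ} → (∀ x y → f x y ≡ g x y) → ∀ xs → pairs f xs ≡ pairs g xs
  pairs-cong f≡g []       = ≡.refl
  pairs-cong f≡g (x ∷ xs) = cong₂ _+_ (∑-cong′ xs (f≡g x)) (pairs-cong f≡g xs)

  -- Only an exchange of two adjacent entries reorders a pair, and the symmetry of `f` makes up for
  -- it.
  pairs-↭ : {f : A → A → ℕ} → (∀ x y → f x y ≡ f y x) → ∀ {xs ys} → xs ↭ ys → pairs f xs ≡ pairs f ys
  pairs-↭ f-sym refl = ≡.refl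
  pairs-↭ {f = f} f-sym (prep x p) = cong₂ _+_ (∑-↭ (f x) p) (pairs-↭ f-sym p)
  pairs-↭ {f = f} f-sym (swap {xs} {ys} x y p)
    rewrite ∑-↭ (f x) p | ∑-↭ (f y) p | pairs-↭ f-sym p | f-sym x y =
    rearrange (f y x) (∑ ys (f x)) (∑ ys (f y)) (pairs f ys)
    where
    rearrange : ∀ a b c d → a + b + (c + d) ≡ a + c + (b + d)
    rearrange = solve-∀
  pairs-↭ f-sym (trans p q) = ≡.trans (pairs-↭ f-sym p) (pairs-↭ f-sym q)

  pairs-++ : (f : A → A → ℕ) (xs ys : List A) →
             pairs f (xs ++ ys) ≡ pairs f xs + ∑ xs (λ x → ∑ ys (f x)) + pairs f ys
  pairs-++ f []       ys = ≡.refl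
  pairs-++ f (x ∷ xs) ys rewrite pairs-++ f xs ys | ∑-++ xs ys (f x) =
    rearrange (∑ xs (f x)) (∑ ys (f x)) (pairs f xs) (∑ xs (λ x → ∑ ys (f x))) (pairs f ys)
    where
    rearrange : ∀ a b c d e → a + b + (c + d + e) ≡ a + c + (b + d) + e
    rearrange = solve-∀

  -- Two positions lie in one block or in two different ones. With a block for each middle vertex,
  -- this separates pairs of paths with the same middle vertex from the others.
  pairs-concatMap : (f : B → B → ℕ) (F : A → List B) (xs : List A) →
                    pairs f (concatMap F xs) ≡
                    ∑ xs (pairs f ∘ F) + pairs (λ x y → ∑ (F x) (λ a → ∑ (F y) (f a))) xs
  pairs-concatMap f F []       = ≡.refl
  pairs-concatMap f F (x ∷ xs)
    rewrite pairs-++ f (F x) (concatMap F xs) | pairs-concatMap f F xs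
          | ∑-cong′ (F x) (λ a → ∑-concatMap F xs (f a))
          | ∑-swap (F x) xs (λ a y → ∑ (F y) (f a)) =
    rearrange (pairs f (F x)) _ _ _
    where
    rearrange : ∀ a b c d → a + b + (c + d) ≡ a + c + (b + d)
    rearrange = solve-∀

  pairs-δ-unique : {xs : List (Fin n)} → Unique xs → pairs (λ x y → 𝟙 (x ≟ᶠ y)) xs ≡ 0
  pairs-δ-unique [] = ≡.refl
  pairs-δ-unique (_∷_ {x} {xs} x∉ uniq)
    rewrite ∑-cong′ xs (λ y → sym (ℕ.*-identityʳ (𝟙 (x ≟ᶠ y)))) | ∑-δ-∉ (λ _ → 1) x∉ = pairs-δ-unique uniq

  -- In an increasing list the order of positions is the order of values. This leads from positions
  -- to a double sum over vertices, the form in which canonical quadruples are counted.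
  pairs-sorted : (f : Fin n → Fin n → ℕ) {xs : List (Fin n)} → AllPairs _<ᶠ_ xs →
                 pairs f xs ≡ ∑ xs (λ x → ∑ xs (λ y → 𝟙 (x <ᶠ? y) * f x y))
  pairs-sorted f [] = ≡.refl
  pairs-sorted {n} f (_∷_ {x} {xs} x< sorted) = begin
    ∑ xs (f x) + pairs f xs
      ≡⟨ cong₂ _+_ (∑-cong xs λ y y∈ → sym (above y (All.lookup x< y∈))) (pairs-sorted f sorted) ⟩
    ∑ xs (g x) + ∑ xs (λ z → ∑ xs (g z))
      ≡⟨ cong₂ _+_ (cong (_+ ∑ xs (g x)) (sym (notBelow x (<ᶠ-irrefl ≡.refl))))
                   (∑-cong xs λ z z∈ → cong (_+ ∑ xs (g z))
                      (sym (notBelow z (<ᶠ-irrefl ≡.refl ∘ <ᶠ-trans (All.lookup x< z∈))))) ⟩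
    g x x + ∑ xs (g x) + ∑ xs (λ z → g z x + ∑ xs (g z)) ∎
    where
    open ≡-Reasoning
    g : Fin n → Fin n → ℕ
    g a b = 𝟙 (a <ᶠ? b) * f a b
    above : ∀ y → x <ᶠ y → g x y ≡ f x y
    above y x<y rewrite 𝟙-yes (x <ᶠ? y) x<y = ℕ.+-identityʳ _
    notBelow : ∀ z → ¬ (z <ᶠ x) → g z x ≡ 0
    notBelow z z≮x rewrite 𝟙-no (z <ᶠ? x) z≮x = ≡.refl

  -- 4-cycles up to rotation and reflection

  -- The partner of the head is deleted from `bs`. No other member of `as` can share that partner,
  -- so all of them keep theirs and the induction goes on.
  length-≤-of-matching : (R : A → B → Set) {as : List A} {bs : List B} →
    AllPairs (λ a a′ → ∀ b → R a b → ¬ R a′ b) as →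
    (∀ {a} → a ∈ as → ∃[ b ] b ∈ bs × R a b) → length as ≤ length bs
  length-≤-of-matching R [] matched = z≤n
  length-≤-of-matching R (_∷_ {a} {as} distinct rest) matched
    with b , b∈ , Rab ← matched (here ≡.refl)
    with ps , qs , ≡.refl ← ∈-∃++ b∈ =
    ℕ.≤-trans (s≤s (length-≤-of-matching R rest avoiding-b)) (ℕ.≤-reflexive length-remove)
    where
    length-remove : suc (length (ps ++ qs)) ≡ length (ps ++ b ∷ qs)
    length-remove rewrite length-++ ps {qs} | length-++ ps {b ∷ qs} = sym (ℕ.+-suc (length ps) (length qs))
    avoiding-b : ∀ {a′} → a′ ∈ as → ∃[ b′ ] b′ ∈ ps ++ qs × R a′ b′
    avoiding-b a′∈ with b′ , b′∈ , Ra′b′ ← matched (there a′∈) with ∈-++⁻ ps b′∈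
    ... | inj₁ b′∈ps            = b′ , ∈-++⁺ˡ b′∈ps , Ra′b′
    ... | inj₂ (here ≡.refl)    = contradiction Ra′b′ (All.lookup distinct a′∈ b Rab)
    ... | inj₂ (there b′∈qs)    = b′ , ∈-++⁺ʳ ps b′∈qs , Ra′b′

  AllPairs-restrict : {S : Rel A 0ℓ} {P : A → Set} {xs : List A} → All P xs → AllPairs S xs →
                      AllPairs (λ x y → P x × P y × S x y) xs
  AllPairs-restrict []         []          = []
  AllPairs-restrict (px ∷ pxs) (sx ∷ sxs) =
    All.zipWith (λ (py , s) → px , py , s) (pxs , sx) ∷ AllPairs-restrict pxs sxs

  module _ {R : Rel A 0ℓ} (R? : Decidable R) where

    deduplicate-distinct : ∀ xs → AllPairs (λ x y → ¬ R x y) (deduplicate R? xs)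
    deduplicate-distinct []       = []
    deduplicate-distinct (x ∷ xs) =
      all-filter (¬? ∘ R? x) (deduplicate R? xs) ∷
      AllPairsₚ.filter⁺ (¬? ∘ R? x) (deduplicate-distinct xs)

    -- Both lists hold exactly one member of each class of `R`, the second because `P` singles out
    -- one representative. Matching along `R` in both directions gives the two inequalities.
    length-deduplicate :
      (∀ {x} → R x x) → (∀ {x y} → R x y → R y x) → (∀ {x y z} → R x y → R y z → R x z) →
      {xs : List A} {P : A → Set} (P? : Unary.Decidable P) → Unique xs →
      (∀ {x} → x ∈ xs → ∃[ y ] y ∈ xs × P y × R x y) →
      (∀ {x y} → P x → P y → R x y → x ≡ y) →
      length (deduplicate R? xs) ≡ length (filter P? xs)
    length-deduplicate R-refl R-sym R-trans {xs} P? uniq represented rigid = ℕ.≤-antisym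
      (length-≤-of-matching R {bs = filter P? xs}
        (AllPairs.map (λ ¬R b Rab Rcb → ¬R (R-trans Rab (R-sym Rcb))) (deduplicate-distinct xs))
        λ a∈ → let y , y∈ , Py , Ray = represented (Anyₚ.deduplicate⁻ R? a∈)
               in y , ∈-filter⁺ P? y∈ Py , Ray)
      (length-≤-of-matching R {filter P? xs}
        (AllPairs.map (λ (Pa , Pc , a≢c) b Rab Rcb → a≢c (rigid Pa Pc (R-trans Rab (R-sym Rcb))))
          (AllPairs-restrict (all-filter P? xs) (filter⁺ P? uniq)))
        λ {a} a∈ → find (Anyₚ.deduplicate⁺ R? {_} {R a} {xs} (λ Rcb Rab → R-trans Rab (R-sym Rcb))
                       (lose (proj₁ (∈-filter⁻ P? {xs = xs} a∈)) R-refl)))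

  module _ {q : Quad n} where

    ≈-refl : q ≈ q
    ≈-refl = here ≡.refl

    -- The eight sequences form an orbit of the dihedral group of the square. Rotation acts as a
    -- 4-cycle on the first four places of the list and as another on the last four.
    ≈-shift : ∀ {q′} → q ≈ q′ → q ≈ shift q′
    ≈-shift (here ≡.refl) = there (here ≡.refl)
    ≈-shift (there (here ≡.refl)) = there (there (here ≡.refl))
    ≈-shift (there (there (here ≡.refl))) = there (there (there (here ≡.refl)))
    ≈-shift (there (there (there (here ≡.refl)))) = here ≡.refl
    ≈-shift (there (there (there (there (here ≡.refl))))) = there (there (there (there (there (here ≡.refl)))))
    ≈-shift (there (there (there (there (there (here ≡.refl)))))) =
      there (there (there (there (there (there (here ≡.refl))))))
    ≈-shift (there (there (there (there (there (there (here ≡.refl))))))) =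
      there (there (there (there (there (there (there (here ≡.refl)))))))
    ≈-shift (there (there (there (there (there (there (there (here ≡.refl)))))))) =
      there (there (there (there (here ≡.refl))))

    -- Reversal conjugates a rotation into its inverse, hence the opposite order in which the
    -- rotations meet the reflections.
    ≈-reversal : ∀ {q′} → q ≈ q′ → q ≈ reversal q′
    ≈-reversal (here ≡.refl) = there (there (there (there (here ≡.refl))))
    ≈-reversal (there (here ≡.refl)) = there (there (there (there (there (there (there (here ≡.refl)))))))
    ≈-reversal (there (there (here ≡.refl))) = there (there (there (there (there (there (here ≡.refl))))))
    ≈-reversal (there (there (there (here ≡.refl)))) = there (there (there (there (there (here ≡.refl)))))
    ≈-reversal (there (there (there (there (here ≡.refl))))) = here ≡.refl
    ≈-reversal (there (there (there (there (there (here ≡.refl)))))) = there (there (there (here ≡.refl)))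
    ≈-reversal (there (there (there (there (there (there (here ≡.refl))))))) = there (there (here ≡.refl))
    ≈-reversal (there (there (there (there (there (there (there (here ≡.refl)))))))) = there (here ≡.refl)

  ≈-trans : {q q′ q″ : Quad n} → q ≈ q′ → q′ ≈ q″ → q ≈ q″
  ≈-trans p (here ≡.refl) = p
  ≈-trans p (there (here ≡.refl)) = ≈-shift p
  ≈-trans p (there (there (here ≡.refl))) = ≈-shift (≈-shift p)
  ≈-trans p (there (there (there (here ≡.refl)))) = ≈-shift (≈-shift (≈-shift p))
  ≈-trans p (there (there (there (there (here ≡.refl))))) = ≈-reversal p
  ≈-trans p (there (there (there (there (there (here ≡.refl)))))) = ≈-shift (≈-reversal p)
  ≈-trans p (there (there (there (there (there (there (here ≡.refl))))))) = ≈-shift (≈-shift (≈-reversal p))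
  ≈-trans p (there (there (there (there (there (there (there (here ≡.refl)))))))) =
    ≈-shift (≈-shift (≈-shift (≈-reversal p)))

  -- A rotation is undone by completing it to four shifts; each reflection is its own inverse.
  ≈-sym : {q q′ : Quad n} → q ≈ q′ → q′ ≈ q
  ≈-sym (here ≡.refl) = ≈-refl
  ≈-sym (there (here ≡.refl)) = ≈-shift (≈-shift (≈-shift ≈-refl))
  ≈-sym (there (there (here ≡.refl))) = ≈-shift (≈-shift ≈-refl)
  ≈-sym (there (there (there (here ≡.refl)))) = ≈-shift ≈-refl
  ≈-sym (there (there (there (there (here ≡.refl))))) = ≈-reversal ≈-refl
  ≈-sym (there (there (there (there (there (here ≡.refl)))))) = ≈-shift (≈-reversal ≈-refl)
  ≈-sym (there (there (there (there (there (there (here ≡.refl))))))) = ≈-shift (≈-shift (≈-reversal ≈-refl))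
  ≈-sym (there (there (there (there (there (there (there (here ≡.refl)))))))) =
    ≈-shift (≈-shift (≈-shift (≈-reversal ≈-refl)))

  module _ (G : Graph n) where
    open Graph G

    infix 4 _≺_ _≺?_

    _≺_ : Rel (Fin n) 0ℓ
    u ≺ v = deg G u < deg G v ⊎ deg G u ≡ deg G v × u <ᶠ v

    -- Abstract, as otherwise `with` fails to find u ≺? v among the unfolded tests.
    abstract
      _≺?_ : Decidable _≺_
      u ≺? v = (deg G u ℕ.<? deg G v) ⊎-dec ((deg G u ℕ.≟ deg G v) ×-dec (u <ᶠ? v))

    ≺⇒deg≤ : ∀ {u v} → u ≺ v → deg G u ≤ deg G v
    ≺⇒deg≤ (inj₁ du<dv)       = ℕ.<⇒≤ du<dv
    ≺⇒deg≤ (inj₂ (du≡dv , _)) = ℕ.≤-reflexive du≡dv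

    ≺-trans : Transitive _≺_
    ≺-trans {k = w} (inj₁ p) q = inj₁ (ℕ.<-≤-trans p (≺⇒deg≤ {v = w} q))
    ≺-trans {u} (inj₂ (p , _)) (inj₁ q) = inj₁ (subst (_< _) (sym p) q)
    ≺-trans (inj₂ (p , u<v)) (inj₂ (q , v<w)) = inj₂ (≡.trans p q , <ᶠ-trans u<v v<w)

    ≺-irrefl : ∀ {u} → ¬ u ≺ u
    ≺-irrefl (inj₁ p) = ℕ.<-irrefl ≡.refl p
    ≺-irrefl (inj₂ (_ , p)) = <ᶠ-irrefl ≡.refl p

    ≺-asym : ∀ {u v} → u ≺ v → ¬ v ≺ u
    ≺-asym {u} p q = ≺-irrefl {u} (≺-trans p q)

    ≺⇒≢ : ∀ {u v} → u ≺ v → u ≢ v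
    ≺⇒≢ {u} u≺v ≡.refl = ≺-irrefl {u} u≺v

    ≺-total : ∀ {u v} → u ≢ v → u ≺ v ⊎ v ≺ u
    ≺-total {u} {v} u≢v with ℕ.<-cmp (deg G u) (deg G v)
    ... | tri< p _ _ = inj₁ (inj₁ p)
    ... | tri> _ _ p = inj₂ (inj₁ p)
    ... | tri≈ _ p _ with <ᶠ-cmp u v
    ...   | tri< q _ _ = inj₁ (inj₂ (p , q))
    ...   | tri≈ _ q _ = contradiction q u≢v
    ...   | tri> _ _ q = inj₂ (inj₂ (sym p , q))

    -- The largest vertex in front fixes the rotation, and the order of its two neighbours on the
    -- cycle fixes the direction.
    Topped Canonical : Quad n → Set
    Topped    (x , y , z , w) = y ≺ x × z ≺ x × w ≺ x
    Canonical q@(x , y , z , w) = IsC4 G q × Topped q × y <ᶠ w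

    canonical? : Unary.Decidable Canonical
    canonical? q@(x , y , z , w) =
      isC4? G q ×-dec ((y ≺? x) ×-dec (z ≺? x) ×-dec (w ≺? x)) ×-dec (y <ᶠ? w)

    shift-C4 : ∀ {q} → IsC4 G q → IsC4 G (shift q)
    shift-C4 (((x≢y ∷ x≢z ∷ x≢w ∷ []) ∷ (y≢z ∷ y≢w ∷ []) ∷ (z≢w ∷ []) ∷ [] ∷ []) , xy , yz , zw , wx) =
      ((y≢z ∷ y≢w ∷ ≢-sym x≢y ∷ []) ∷ (z≢w ∷ ≢-sym x≢z ∷ []) ∷ (≢-sym x≢w ∷ []) ∷ [] ∷ []) , yz , zw , wx , xy

    reversal-C4 : ∀ {q} → IsC4 G q → IsC4 G (reversal q)
    reversal-C4 (((x≢y ∷ x≢z ∷ x≢w ∷ []) ∷ (y≢z ∷ y≢w ∷ []) ∷ (z≢w ∷ []) ∷ [] ∷ []) , xy , yz , zw , wx) =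
      ((≢-sym z≢w ∷ ≢-sym y≢w ∷ ≢-sym x≢w ∷ []) ∷ (≢-sym y≢z ∷ ≢-sym x≢z ∷ []) ∷ (≢-sym x≢y ∷ []) ∷ [] ∷ []) ,
      ~-sym zw , ~-sym yz , ~-sym xy , ~-sym wx

    -- A knock-out tournament: `x` against `y`, `z` against `w`, then the two winners. The number of
    -- shifts is the place of the overall winner.
    topped-representative : ∀ q → IsC4 G q → ∃[ q′ ] q ≈ q′ × IsC4 G q′ × Topped q′
    topped-representative q@(x , y , z , w)
      c@(((x≢y ∷ x≢z ∷ x≢w ∷ []) ∷ (y≢z ∷ y≢w ∷ []) ∷ (z≢w ∷ []) ∷ [] ∷ []) , _)
      with ≺-total x≢y | ≺-total z≢w
    ... | inj₂ y≺x | inj₂ w≺z with ≺-total x≢z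
    ...   | inj₂ z≺x = q , ≈-refl , c , y≺x , z≺x , ≺-trans w≺z z≺x
    ...   | inj₁ x≺z = shift (shift q) , ≈-shift (≈-shift ≈-refl) , shift-C4 (shift-C4 c) ,
                       w≺z , x≺z , ≺-trans y≺x x≺z
    topped-representative q c@(((_ ∷ _ ∷ x≢w ∷ []) ∷ _) , _) | inj₂ y≺x | inj₁ z≺w with ≺-total x≢w
    ...   | inj₂ w≺x = q , ≈-refl , c , y≺x , ≺-trans z≺w w≺x , w≺x
    ...   | inj₁ x≺w = shift (shift (shift q)) , ≈-shift (≈-shift (≈-shift ≈-refl)) ,
                       shift-C4 (shift-C4 (shift-C4 c)) , x≺w , ≺-trans y≺x x≺w , z≺w
    topped-representative q c@((_ ∷ (y≢z ∷ _) ∷ _) , _) | inj₁ x≺y | inj₂ w≺z with ≺-total y≢z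
    ...   | inj₂ z≺y = shift q , ≈-shift ≈-refl , shift-C4 c , z≺y , ≺-trans w≺z z≺y , x≺y
    ...   | inj₁ y≺z = shift (shift q) , ≈-shift (≈-shift ≈-refl) , shift-C4 (shift-C4 c) ,
                       w≺z , ≺-trans x≺y y≺z , y≺z
    topped-representative q c@((_ ∷ (_ ∷ y≢w ∷ []) ∷ _) , _) | inj₁ x≺y | inj₁ z≺w with ≺-total y≢w
    ...   | inj₂ w≺y = shift q , ≈-shift ≈-refl , shift-C4 c , ≺-trans z≺w w≺y , w≺y , x≺y
    ...   | inj₁ y≺w = shift (shift (shift q)) , ≈-shift (≈-shift (≈-shift ≈-refl)) ,
                       shift-C4 (shift-C4 (shift-C4 c)) , ≺-trans x≺y y≺w , y≺w , z≺w

    canonical-representative : ∀ {q} → IsC4 G q → ∃[ q′ ] q ≈ q′ × Canonical q′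
    canonical-representative {q} c
      with q′@(x , y , z , w) , q≈q′ , c′@((_ ∷ (_ ∷ y≢w ∷ []) ∷ _) , _) , top@(y≺x , z≺x , w≺x) ←
           topped-representative q c
      with <ᶠ-cmp y w
    ... | tri< y<w _ _ = q′ , q≈q′ , c′ , top , y<w
    ... | tri≈ _ y≡w _ = contradiction y≡w y≢w
    -- Reversal moves the top to the last place, and three shifts bring it back to the front; the
    -- net effect is to exchange `y` and `w`.
    ... | tri> _ _ w<y =
      shift (shift (shift (reversal q′))) , ≈-shift (≈-shift (≈-shift (≈-reversal q≈q′))) ,
      shift-C4 (shift-C4 (shift-C4 (reversal-C4 c′))) , (w≺x , z≺x , y≺x) , w<y

    -- Six of the seven other members of the orbit have a different vertex in front, against the
    -- asymmetry of `≺`. The seventh is the reflection that fixes `x`; it exchanges `y` and `w`,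
    -- against `y <ᶠ w`.
    canonical-rigid : ∀ {q q′} → Canonical q → Canonical q′ → q ≈ q′ → q ≡ q′
    canonical-rigid _ _ (here ≡.refl) = ≡.refl
    canonical-rigid (_ , (y≺x , _) , _) (_ , (_ , _ , x≺y) , _) (there (here ≡.refl)) =
      contradiction x≺y (≺-asym y≺x)
    canonical-rigid (_ , (_ , z≺x , _) , _) (_ , (_ , x≺z , _) , _) (there (there (here ≡.refl))) =
      contradiction x≺z (≺-asym z≺x)
    canonical-rigid (_ , (_ , _ , w≺x) , _) (_ , (x≺w , _ , _) , _) (there (there (there (here ≡.refl)))) =
      contradiction x≺w (≺-asym w≺x)
    canonical-rigid (_ , (_ , _ , w≺x) , _) (_ , (_ , _ , x≺w) , _) (there (there (there (there (here ≡.refl))))) =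
      contradiction x≺w (≺-asym w≺x)
    canonical-rigid (_ , (_ , z≺x , _) , _) (_ , (_ , x≺z , _) , _) (there (there (there (there (there (here ≡.refl)))))) =
      contradiction x≺z (≺-asym z≺x)
    canonical-rigid (_ , (y≺x , _) , _) (_ , (x≺y , _) , _) (there (there (there (there (there (there (here ≡.refl))))))) =
      contradiction x≺y (≺-asym y≺x)
    canonical-rigid (_ , _ , y<w) (_ , _ , w<y) (there (there (there (there (there (there (there (here ≡.refl)))))))) =
      contradiction w<y (<ᶠ-asym y<w)

    quads-unique : Unique (quads G)
    quads-unique = cartesianProduct⁺ V⁺ (cartesianProduct⁺ V⁺ (cartesianProduct⁺ V⁺ V⁺))
      where V⁺ = allFin⁺ n

    ∈-quads : ∀ q → q ∈ quads G
    ∈-quads (x , y , z , w) =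
      ∈-cartesianProduct⁺ (∈-allFin x) (∈-cartesianProduct⁺ (∈-allFin y)
        (∈-cartesianProduct⁺ (∈-allFin z) (∈-allFin w)))

    □-canonical : □ G ≡ ∑ (quads G) (λ q → 𝟙 (canonical? q))
    □-canonical = begin
      □ G                                      ≡⟨ length-deduplicate _≈?_ ≈-refl ≈-sym ≈-trans canonical?
                                                    (filter⁺ (isC4? G) quads-unique) represented canonical-rigid ⟩
      length (filter canonical? (filter (isC4? G) (quads G)))
                                               ≡⟨ length-filter-∑ canonical? (filter (isC4? G) (quads G)) ⟩
      ∑ (filter (isC4? G) (quads G)) (λ q → 𝟙 (canonical? q))
                                               ≡⟨ ∑-filter (isC4? G) (quads G) _ ⟩
      ∑ (quads G) (λ q → 𝟙 (isC4? G q) * 𝟙 (canonical? q))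
                                               ≡⟨ ∑-cong′ (quads G) absorb ⟩
      ∑ (quads G) (λ q → 𝟙 (canonical? q))     ∎
      where
      open ≡-Reasoning
      represented : ∀ {q} → q ∈ filter (isC4? G) (quads G) →
                    ∃[ q′ ] q′ ∈ filter (isC4? G) (quads G) × Canonical q′ × q ≈ q′
      represented q∈ with q′ , q≈q′ , can ← canonical-representative (proj₂ (∈-filter⁻ (isC4? G) {xs = quads G} q∈)) =
        q′ , ∈-filter⁺ (isC4? G) (∈-quads q′) (proj₁ can) , can , q≈q′
      absorb : ∀ q → 𝟙 (isC4? G q) * 𝟙 (canonical? q) ≡ 𝟙 (canonical? q)
      absorb q = ≡.trans (sym (𝟙-× (isC4? G q) (canonical? q)))
        (𝟙-⇔ (isC4? G q ×-dec canonical? q) (canonical? q) proj₂ (λ can → proj₁ can , can))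

  -- Counting 4-cycles at their largest vertex

  δ : ∀ {n} → Fin n → Fin n → ℕ
  δ x y = 𝟙 (x ≟ᶠ y)

  δ-sym : ∀ {n} (x y : Fin n) → δ x y ≡ δ y x
  δ-sym x y = 𝟙-⇔ (x ≟ᶠ y) (y ≟ᶠ x) sym sym

  𝟙-idem : ∀ {P : Set} (p? : Dec P) → 𝟙 p? * 𝟙 p? ≡ 𝟙 p?
  𝟙-idem (yes _) = ≡.refl
  𝟙-idem (no _)  = ≡.refl

  allFin-sorted : ∀ n → AllPairs _<ᶠ_ (allFin n)
  allFin-sorted n = AllPairsₚ.tabulate⁺-< λ i<j → i<j

  module _ {n : ℕ} {G : Graph n} (A : AdjacencyLists G) where
    open Graph G
    open AdjacencyLists A

    ∈-nbrs⁻ : ∀ {u v} → u ∈ nbrs v → v ~ u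
    ∈-nbrs⁻ {u} {v} u∈ = proj₂ (∈-filter⁻ (v ~?_) {xs = (allFin n)} (∈-resp-↭ (nbrs-↭ v) u∈))

    ∈-nbrs⁺ : ∀ {u v} → v ~ u → u ∈ nbrs v
    ∈-nbrs⁺ {u} {v} v~u = ∈-resp-↭ (↭-sym (nbrs-↭ v)) (∈-filter⁺ (v ~?_) (∈-allFin u) v~u)

    length-nbrs : ∀ v → length (nbrs v) ≡ deg G v
    length-nbrs v = ↭-length (nbrs-↭ v)

    ∑-nbrs : ∀ v (f : Fin n → ℕ) → ∑ (nbrs v) f ≡ ∑ (allFin n) (λ u → 𝟙 (v ~? u) * f u)
    ∑-nbrs v f = ≡.trans (∑-↭ f (nbrs-↭ v)) (∑-filter (v ~?_) (allFin n) f)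

    below : Fin n → List (Fin n) → List (Fin n)
    below v = filter (λ u → _≺?_ G u v)

    -- The multiset of path ends, kept as a list in the order in which the program meets them, so
    -- that the program's effect is a recursion on it.
    hits : Fin n → List (Fin n)
    hits v = concatMap (below v ∘ nbrs) (below v (nbrs v))

    -- The codegree of `u` and `u′` within the vertices below `v`.
    common : Fin n → Fin n → Fin n → ℕ
    common v u u′ = ∑ (allFin n) (λ y → 𝟙 (_≺?_ G y v) * (𝟙 (u ~? y) * 𝟙 (u′ ~? y)))

    common-sym : ∀ v u u′ → common v u u′ ≡ common v u′ u
    common-sym v u u′ = ∑-cong′ (allFin n) λ y → cong (𝟙 (_≺?_ G y v) *_) (ℕ.*-comm (𝟙 (u ~? y)) _)

    -- An adjacency list has no repetitions, so the counters never pair a path with another path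
    -- through the same middle vertex.
    pairs-block : ∀ v u → pairs δ (below v (nbrs u)) ≡ 0
    pairs-block v u = ≡.trans (pairs-↭ δ-sym (filter-↭ (λ u → _≺?_ G u v) (nbrs-↭ u)))
      (pairs-δ-unique (filter⁺ (λ u → _≺?_ G u v) (filter⁺ (u ~?_) (allFin⁺ n))))

    -- A coincidence between two blocks is a common neighbour. The test against `v` enters once from
    -- each block, and idempotence merges the two.
    ∑∑-blocks : ∀ v u u′ → ∑ (below v (nbrs u)) (λ a → ∑ (below v (nbrs u′)) (δ a)) ≡ common v u u′
    ∑∑-blocks v u u′ = begin
      ∑ (below v (nbrs u)) (λ a → ∑ (below v (nbrs u′)) (δ a))
        ≡⟨ ∑-cong′ (below v (nbrs u)) inner ⟩
      ∑ (below v (nbrs u)) (λ a → 𝟙 (u′ ~? a) * ≺v a)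
        ≡⟨ ≡.trans (∑-filter _ (nbrs u) _) (∑-nbrs u _) ⟩
      ∑ (allFin n) (λ a → 𝟙 (u ~? a) * (≺v a * (𝟙 (u′ ~? a) * ≺v a)))
        ≡⟨ ∑-cong′ (allFin n) (λ a → ≡.trans (rearrange (𝟙 (u ~? a)) (≺v a) (𝟙 (u′ ~? a)))
              (cong (_* (𝟙 (u ~? a) * 𝟙 (u′ ~? a))) (𝟙-idem (_≺?_ G a v)))) ⟩
      common v u u′ ∎
      where
      open ≡-Reasoning
      ≺v : Fin n → ℕ
      ≺v a = 𝟙 (_≺?_ G a v)
      rearrange : ∀ x b y → x * (b * (y * b)) ≡ b * b * (x * y)
      rearrange = solve-∀
      swap-factors : ∀ x y z → x * (y * z) ≡ z * (x * y)
      swap-factors = solve-∀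
      inner : ∀ a → ∑ (below v (nbrs u′)) (δ a) ≡ 𝟙 (u′ ~? a) * ≺v a
      inner a = begin
        ∑ (below v (nbrs u′)) (δ a)
          ≡⟨ ≡.trans (∑-filter _ (nbrs u′) _) (∑-nbrs u′ _) ⟩
        ∑ (allFin n) (λ b → 𝟙 (u′ ~? b) * (≺v b * δ a b))
          ≡⟨ ∑-cong′ (allFin n) (λ b → swap-factors (𝟙 (u′ ~? b)) (≺v b) (δ a b)) ⟩
        ∑ (allFin n) (λ b → δ a b * (𝟙 (u′ ~? b) * ≺v b))
          ≡⟨ ∑-δ-allFin a _ ⟩
        𝟙 (u′ ~? a) * ≺v a ∎

    -- Distinctness is recovered from the factors: `≺` separates `v` from the rest, `<ᶠ` separates
    -- `u` from `u′`, and irreflexivity of adjacency separates `y` from both.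
    𝟙-canonical : ∀ v u y u′ → 𝟙 (canonical? G (v , u , y , u′)) ≡
      𝟙 (v ~? u) * (𝟙 (_≺?_ G u v) * (𝟙 (v ~? u′) * (𝟙 (_≺?_ G u′ v) *
        (𝟙 (u <ᶠ? u′) * (𝟙 (_≺?_ G y v) * (𝟙 (u ~? y) * 𝟙 (u′ ~? y)))))))
    𝟙-canonical v u y u′ = begin
      𝟙 (canonical? G (v , u , y , u′))
        ≡⟨ 𝟙-⇔ (canonical? G (v , u , y , u′)) factors?
             (λ { ((_ , vu , uy , yu′ , u′v) , (u≺v , y≺v , u′≺v) , u<u′) →
                  vu , u≺v , ~-sym u′v , u′≺v , u<u′ , y≺v , uy , ~-sym yu′ })
             (λ (vu , u≺v , vu′ , u′≺v , u<u′ , y≺v , uy , u′y) →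
                ( ((≢-sym (≺⇒≢ G u≺v) ∷ ≢-sym (≺⇒≢ G y≺v) ∷ ≢-sym (≺⇒≢ G u′≺v) ∷ []) ∷
                   ((λ { ≡.refl → ~-irrefl ≡.refl uy }) ∷ <ᶠ⇒≢ u<u′ ∷ []) ∷
                   ((λ { ≡.refl → ~-irrefl ≡.refl u′y }) ∷ []) ∷ [] ∷ [])
                , vu , uy , ~-sym u′y , ~-sym vu′) ,
                (u≺v , y≺v , u′≺v) , u<u′) ⟩
      𝟙 factors?
        ≡⟨ 𝟙-×-cong (v ~? u) f₁? (𝟙-×-cong (_≺?_ G u v) f₂? (𝟙-×-cong (v ~? u′) f₃? (𝟙-×-cong (_≺?_ G u′ v) f₄?
             (𝟙-×-cong (u <ᶠ? u′) f₅? (𝟙-×-cong (_≺?_ G y v) f₆? (𝟙-× (u ~? y) (u′ ~? y))))))) ⟩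
      _ ∎
      where
      open ≡-Reasoning
      f₆? = (u ~? y) ×-dec (u′ ~? y)
      f₅? = (_≺?_ G y v) ×-dec f₆?
      f₄? = (u <ᶠ? u′) ×-dec f₅?
      f₃? = (_≺?_ G u′ v) ×-dec f₄?
      f₂? = (v ~? u′) ×-dec f₃?
      f₁? = (_≺?_ G u v) ×-dec f₂?
      factors? = (v ~? u) ×-dec f₁?
      𝟙-×-cong : ∀ {P Q : Set} (p? : Dec P) (q? : Dec Q) {m} → 𝟙 q? ≡ m → 𝟙 (p? ×-dec q?) ≡ 𝟙 p? * m
      𝟙-×-cong p? q? eq = ≡.trans (𝟙-× p? q?) (cong (𝟙 p? *_) eq)

    cycles : Fin n → ℕ
    cycles v = pairs δ (hits v)

    cycles-canonical : ∀ v →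
      cycles v ≡ ∑ (allFin n) (λ u → ∑ (allFin n) (λ y → ∑ (allFin n) (λ u′ → 𝟙 (canonical? G (v , u , y , u′)))))
    cycles-canonical v = begin
      pairs δ (hits v)
        ≡⟨ pairs-concatMap δ (below v ∘ nbrs) (below v (nbrs v)) ⟩
      ∑ (below v (nbrs v)) (pairs δ ∘ below v ∘ nbrs) +
      pairs (λ u u′ → ∑ (below v (nbrs u)) (λ a → ∑ (below v (nbrs u′)) (δ a))) (below v (nbrs v))
        ≡⟨ cong₂ _+_ (≡.trans (∑-cong′ (below v (nbrs v)) (pairs-block v)) (∑-0 (below v (nbrs v))))
                     (pairs-cong (∑∑-blocks v) (below v (nbrs v))) ⟩
      pairs (common v) (below v (nbrs v))
        -- `N` is increasing, unlike the given list, so after this exchange the order of positions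
        -- can be read as `u <ᶠ u′`.
        ≡⟨ pairs-↭ (common-sym v) (filter-↭ _ (nbrs-↭ v)) ⟩
      pairs (common v) (below v (N G v))
        ≡⟨ pairs-sorted (common v) (AllPairsₚ.filter⁺ _ (AllPairsₚ.filter⁺ (v ~?_) (allFin-sorted n))) ⟩
      ∑ (below v (N G v)) (λ u → ∑ (below v (N G v)) (λ u′ → 𝟙 (u <ᶠ? u′) * common v u u′))
        ≡⟨ ∑-below-N _ ⟩
      ∑ (allFin n) (λ u → 𝟙 (v ~? u) * (≺v u * ∑ (below v (N G v)) (λ u′ → 𝟙 (u <ᶠ? u′) * common v u u′)))
        ≡⟨ ∑-cong′ (allFin n) (λ u → cong (λ s → 𝟙 (v ~? u) * (≺v u * s)) (∑-below-N _)) ⟩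
      ∑ (allFin n) (λ u → 𝟙 (v ~? u) * (≺v u * ∑ (allFin n) (λ u′ → 𝟙 (v ~? u′) * (≺v u′ * (𝟙 (u <ᶠ? u′) * common v u u′)))))
        ≡⟨ ∑-cong′ (allFin n) expand ⟩
      ∑ (allFin n) (λ u → ∑ (allFin n) (λ y → ∑ (allFin n) (λ u′ → 𝟙 (canonical? G (v , u , y , u′))))) ∎
      where
      open ≡-Reasoning
      ≺v : Fin n → ℕ
      ≺v a = 𝟙 (_≺?_ G a v)
      ∑-below-N : ∀ f → ∑ (below v (N G v)) f ≡ ∑ (allFin n) (λ u → 𝟙 (v ~? u) * (≺v u * f u))
      ∑-below-N f = ≡.trans (∑-filter _ (N G v) f) (∑-filter (v ~?_) (allFin n) _)
      pull : (c : ℕ) {s : ℕ} (f : Fin n → ℕ) → s ≡ ∑ (allFin n) f → c * s ≡ ∑ (allFin n) (λ y → c * f y)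
      pull c f eq = ≡.trans (cong (c *_) eq) (sym (∑-*ˡ (allFin n) c f))
      expand : ∀ u →
        𝟙 (v ~? u) * (≺v u * ∑ (allFin n) (λ u′ → 𝟙 (v ~? u′) * (≺v u′ * (𝟙 (u <ᶠ? u′) * common v u u′)))) ≡
        ∑ (allFin n) (λ y → ∑ (allFin n) (λ u′ → 𝟙 (canonical? G (v , u , y , u′))))
      expand u = begin
        𝟙 (v ~? u) * (≺v u * ∑ (allFin n) (λ u′ → 𝟙 (v ~? u′) * (≺v u′ * (𝟙 (u <ᶠ? u′) * common v u u′))))
          ≡⟨ pull (𝟙 (v ~? u)) _ (pull (≺v u) _ ≡.refl) ⟩
        ∑ (allFin n) (λ u′ → 𝟙 (v ~? u) * (≺v u * (𝟙 (v ~? u′) * (≺v u′ * (𝟙 (u <ᶠ? u′) * common v u u′)))))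
          ≡⟨ ∑-cong′ (allFin n) (λ u′ → pull (𝟙 (v ~? u)) _ (pull (≺v u) _ (pull (𝟙 (v ~? u′)) _
               (pull (≺v u′) _ (pull (𝟙 (u <ᶠ? u′)) _ ≡.refl))))) ⟩
        ∑ (allFin n) (λ u′ → ∑ (allFin n) (λ y → 𝟙 (v ~? u) * (≺v u * (𝟙 (v ~? u′) * (≺v u′ *
          (𝟙 (u <ᶠ? u′) * (≺v y * (𝟙 (u ~? y) * 𝟙 (u′ ~? y)))))))))
          ≡⟨ ∑-cong′ (allFin n) (λ u′ → ∑-cong′ (allFin n) (λ y → sym (𝟙-canonical v u y u′))) ⟩
        ∑ (allFin n) (λ u′ → ∑ (allFin n) (λ y → 𝟙 (canonical? G (v , u , y , u′))))
          ≡⟨ ∑-swap (allFin n) (allFin n) (λ u′ y → 𝟙 (canonical? G (v , u , y , u′))) ⟩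
        ∑ (allFin n) (λ y → ∑ (allFin n) (λ u′ → 𝟙 (canonical? G (v , u , y , u′)))) ∎

    □-cycles : □ G ≡ ∑ (allFin n) cycles
    □-cycles = begin
      □ G
        ≡⟨ □-canonical G ⟩
      ∑ (quads G) (λ q → 𝟙 (canonical? G q))
        ≡⟨ ∑-cartesianProduct (allFin n) VVV _ ⟩
      ∑ (allFin n) (λ v → ∑ VVV (λ q → 𝟙 (canonical? G (v , q))))
        ≡⟨ ∑-cong′ (allFin n) (λ v → ≡.trans (∑-cartesianProduct (allFin n) (cartesianProduct (allFin n) (allFin n)) _)
             (∑-cong′ (allFin n) (λ u → ∑-cartesianProduct (allFin n) (allFin n) (λ q → 𝟙 (canonical? G (v , u , q)))))) ⟩
      ∑ (allFin n) (λ v → ∑ (allFin n) (λ u → ∑ (allFin n) (λ y → ∑ (allFin n) (λ u′ → 𝟙 (canonical? G (v , u , y , u′))))))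
        ≡⟨ ∑-cong′ (allFin n) (λ v → sym (cycles-canonical v)) ⟩
      ∑ (allFin n) cycles ∎
      where
      open ≡-Reasoning
      VVV = cartesianProduct (allFin n) (cartesianProduct (allFin n) (allFin n))

  -- Executions with bounded cost

  module _ {r n : ℕ} (I : Input n) (W : ℕ) where

    -- A Hoare triple for total correctness. The time is only bounded from above, so branches of
    -- different cost can share one bound.
    Exec : Comm r → State r n → ℕ → (State r n → Set) → Set
    Exec c s T Q = ∃[ t ] ∃[ s′ ] Run I W c s t s′ × t ≤ T × Q s′

  module _ {r n : ℕ} {I : Input n} {W : ℕ} where

    skip-exec : ∀ {s : State r n} {Q} → Q s → Exec I W skip s 1 Q
    skip-exec q = 1 , _ , skip , ℕ.≤-refl , q

    assign-exec : ∀ {s : State r n} {x e v Q} → Eval I s e v → v < W →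
                  Q ⟨ vars s [ x ]≔ v , array s ⟩ → Exec I W (x ≔ e) s 1 Q
    assign-exec e v<W q = 1 , _ , assign e v<W , ℕ.≤-refl , q

    store-exec : ∀ {s : State r n} {a b Q} (i : Fin n) → ⟦_⟧ I a s ≡ toℕ i → ⟦_⟧ I b s < W →
                 Q ⟨ vars s , array s [ i ]≔ ⟦_⟧ I b s ⟩ → Exec I W (work[ a ]≔ b) s 1 Q
    store-exec i a≡i b<W q = 1 , _ , store i a≡i b<W , ℕ.≤-refl , q

    infixr 4 _⨾ₑ_
    -- The postcondition of the first command is the execution of the second. Proofs thus follow the
    -- program in continuation style, without naming the states between.
    seq-exec : ∀ {s : State r n} {c₁ c₂ T₁ T₂ Q} →
               Exec I W c₁ s T₁ (λ s₁ → Exec I W c₂ s₁ T₂ Q) → Exec I W (c₁ ⨾ c₂) s (T₁ + T₂) Q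
    seq-exec (t₁ , s₁ , r₁ , t₁≤ , t₂ , s₂ , r₂ , t₂≤ , q) =
      t₁ + t₂ , s₂ , seq r₁ r₂ , ℕ.+-mono-≤ t₁≤ t₂≤ , q

    _⨾ₑ_ : ∀ {s : State r n} {x e v c T Q} → Eval I s e v × v < W →
           Exec I W c ⟨ vars s [ x ]≔ v , array s ⟩ T Q → Exec I W ((x ≔ e) ⨾ c) s (1 + T) Q
    (e , v<W) ⨾ₑ rest = seq-exec (assign-exec e v<W rest)

    weaken : ∀ {s : State r n} {c T T′ Q Q′} → T ≤ T′ → (∀ {s′} → Q s′ → Q′ s′) →
             Exec I W c s T Q → Exec I W c s T′ Q′
    weaken T≤ Q⇒ (t , s′ , r , t≤ , q) = t , s′ , r , ℕ.≤-trans t≤ T≤ , Q⇒ q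

    true-exec : ∀ {s : State r n} {b c₁ c₂ T Q} → ⟦_⟧ᵗ I b s ≡ true →
                Exec I W c₁ s T Q → Exec I W (cond b c₁ c₂) s (1 + T) Q
    true-exec b (t , s′ , r , t≤ , q) = 1 + t , s′ , cond-true b r , s≤s t≤ , q

    false-exec : ∀ {s : State r n} {b c₁ c₂ T Q} → ⟦_⟧ᵗ I b s ≡ false →
                 Exec I W c₂ s T Q → Exec I W (cond b c₁ c₂) s (1 + T) Q
    false-exec b (t , s′ , r , t≤ , q) = 1 + t , s′ , cond-false b r , s≤s t≤ , q

    -- The list of items still to be handled is the variant of the loop: it yields termination and
    -- the cost together. Each item pays for its own test, and the leading 1 for the failing one.
    while-exec : ∀ {A : Set} {b c} (Inv : List A → State r n → Set) (f : A → ℕ) →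
      (∀ {s} → Inv [] s → ⟦_⟧ᵗ I b s ≡ false) →
      (∀ {x xs s} → Inv (x ∷ xs) s → ⟦_⟧ᵗ I b s ≡ true × Exec I W c s (f x) (Inv xs)) →
      ∀ xs {s} → Inv xs s → Exec I W (while b c) s (1 + ∑ xs (suc ∘ f)) (Inv [])
    while-exec Inv f stop step [] inv = 1 , _ , while-false (stop inv) , ℕ.≤-refl , inv
    while-exec Inv f stop step (x ∷ xs) inv
      with b , t₁ , s₁ , r₁ , t₁≤ , inv₁ ← step inv
      with t₂ , s₂ , r₂ , t₂≤ , inv₂ ← while-exec Inv f stop step xs inv₁ =
      1 + t₁ + t₂ , s₂ , while-true b r₁ r₂ ,
      ℕ.≤-trans (ℕ.+-mono-≤ (s≤s t₁≤) t₂≤) (ℕ.≤-reflexive (ℕ.+-suc (suc (f x)) _)) , inv₂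

  -- The program

  -- xₚ runs over the table, xᵥ is the vertex at hand and xdᵥ its degree; xᵢ runs over the block of
  -- xᵥ up to xₑ, and xⱼ over the block of xᵤ up to xf; xc is the output and xt is temporary.  Only in
  -- `visit` is xᵢ , … , xₑ the block of xᵤ, the first neighbour of xᵥ.
  pattern xₚ  = 0F
  pattern xᵥ  = 1F
  pattern xdᵥ = 2F
  pattern xᵢ  = 3F
  pattern xₑ  = 4F
  pattern xᵤ  = 5F
  pattern xdᵤ = 6F
  pattern xⱼ  = 7F
  pattern xf  = 8F
  pattern xy  = 9F
  pattern xdy = suc 9F
  pattern xc  = suc (suc 9F)
  pattern xt  = suc (suc (suc 9F))

  ifPrecedes : (a da : Fin 13) → Comm 13 → Comm 13
  ifPrecedes a da c =
    cond (var da <ᵗ var xdᵥ) c (cond (var da =ᵗ var xdᵥ) (cond (var a <ᵗ var xᵥ) c skip) skip)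

  blockLoop : Comm 13 → Comm 13
  blockLoop c = while (var xⱼ <ᵗ var xf)
    (xy ≔ read table (var xⱼ) ⨾ xdy ≔ read degree (var xy) ⨾
     ifPrecedes xy xdy c ⨾ xⱼ ≔ var xⱼ ⊕ lit 1)

  pass : Comm 13 → Comm 13
  pass c =
    xdᵥ ≔ read degree (var xᵥ) ⨾ xᵢ ≔ read start (var xᵥ) ⨾ xₑ ≔ var xᵢ ⊕ var xdᵥ ⨾
    while (var xᵢ <ᵗ var xₑ)
      (xᵤ ≔ read table (var xᵢ) ⨾ xdᵤ ≔ read degree (var xᵤ) ⨾
       ifPrecedes xᵤ xdᵤ
         (xⱼ ≔ read start (var xᵤ) ⨾ xf ≔ var xⱼ ⊕ var xdᵤ ⨾ blockLoop c) ⨾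
       xᵢ ≔ var xᵢ ⊕ lit 1)

  reset count process visit countCycles : Comm 13
  reset = work[ var xy ]≔ lit 0
  count = xt ≔ read work (var xy) ⨾ xc ≔ var xc ⊕ var xt ⨾ xt ≔ var xt ⊕ lit 1 ⨾ work[ var xy ]≔ var xt
  process = pass reset ⨾ pass count
  visit =
    xᵥ ≔ read table (var xₚ) ⨾ xt ≔ read start (var xᵥ) ⨾ xᵤ ≔ read table (var xt) ⨾
    xᵢ ≔ read start (var xᵤ) ⨾ xdᵤ ≔ read degree (var xᵤ) ⨾ xₑ ≔ var xᵢ ⊕ var xdᵤ ⨾
    -- The owner of position `xₚ` is not recorded anywhere; it is `xᵤ` exactly if `xₚ` falls into
    -- the block of `xᵤ`.
    cond (var xₚ <ᵗ var xᵢ) skip (cond (var xₚ <ᵗ var xₑ) process skip) ⨾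
    xₚ ≔ var xₚ ⊕ lit 1
  countCycles = xc ≔ val (lit 0) ⨾ xₚ ≔ val (lit 0) ⨾ while (var xₚ <ᵗ size) visit

  -- Output, temporary and work array: all that the body of a pass may change.
  Memory : ℕ → Set
  Memory n = ℕ × ℕ × Vec ℕ n

  state : ∀ {n} (p v dv i e u du j f y dy : ℕ) → Memory n → State 13 n
  state p v dv i e u du j f y dy (c , t , w) =
    ⟨ p ∷ v ∷ dv ∷ i ∷ e ∷ u ∷ du ∷ j ∷ f ∷ y ∷ dy ∷ c ∷ t ∷ [] , w ⟩

  -- Reading the encoded graph and executing a pass

  lookup-fromList : ∀ (xs ys : List ℕ) {y zs} → xs ≡ ys ++ y ∷ zs →
                    ∃[ i ] length ys ≡ toℕ i × lookup (fromList xs) i ≡ y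
  lookup-fromList _ []       ≡.refl = zero , ≡.refl , ≡.refl
  lookup-fromList _ (_ ∷ ys) ≡.refl with i , p , q ← lookup-fromList _ ys ≡.refl =
    suc i , cong suc p , q

  module _ {n : ℕ} {G : Graph n} (A : AdjacencyLists G) where
    open Graph G
    open AdjacencyLists A

    entries : List (Fin n)
    entries = concatMap nbrs (allFin n)

    blockStart : Fin n → ℕ
    blockStart v = length (concatMap nbrs (take (toℕ v) (allFin n)))

    -- A segment of the table by its position. In a loop, `us` is the unread rest of the current
    -- block.
    At : ℕ → List (Fin n) → Set
    At i us = ∃[ before ] ∃[ after ] entries ≡ before ++ us ++ after × length before ≡ i

    At-step : ∀ {i u us} → At i (u ∷ us) → At (i + 1) us
    At-step {u = u} {us} (before , after , eq , ≡.refl) =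
      before ++ u ∷ [] , after , ≡.trans eq (sym (++-assoc before (u ∷ []) (us ++ after))) ,
      length-++ before

    At-≤ : ∀ {i us} → At i us → i + length us ≤ length entries
    At-≤ {us = us} (before , after , eq , ≡.refl) rewrite eq | length-++ before {us ++ after} | length-++ us {after} =
      ℕ.+-monoʳ-≤ (length before) (ℕ.m≤m+n (length us) (length after))

    private
      Evaluates : State 13 n → Expr 13 → ℕ → Set
      Evaluates = Eval (encode A)

    eval-table : ∀ {s a i u us} → At i (u ∷ us) → ⟦_⟧ (encode A) a s ≡ i → Evaluates s (read table a) (toℕ u)
    eval-table {s} {a} {u = u} {us} (before , after , eq , ≡.refl) a≡i
      with k , p , q ← lookup-fromList (map toℕ entries) (map toℕ before)
             (≡.trans (cong (map toℕ) eq) (map-++ toℕ before (u ∷ us ++ after))) =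
      subst (Evaluates s (read table a)) q
        (read k (≡.trans a≡i (≡.trans (sym (length-map toℕ before)) p)))

    eval-degree : ∀ {s a u} → ⟦_⟧ (encode A) a s ≡ toℕ u → Evaluates s (read degree a) (deg G u)
    eval-degree {s} {a} {u} a≡u = subst (Evaluates s (read degree a)) (lookup∘tabulate (deg G) u) (read u a≡u)

    eval-start : ∀ {s a u} → ⟦_⟧ (encode A) a s ≡ toℕ u → Evaluates s (read start a) (blockStart u)
    eval-start {s} {a} {u} a≡u = subst (Evaluates s (read start a)) (lookup∘tabulate blockStart u) (read u a≡u)

    -- `hits` generalised to the neighbours not yet read, as the invariant of the outer loop
    -- requires.
    hitsVia : Fin n → List (Fin n) → List (Fin n)
    hitsVia v us = concatMap (below A v ∘ nbrs) (below A v us)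

    -- Each 8 is a loop test, two reads, 4 for the comparison and an increment. The 3 is two
    -- assignments and the last loop test, the 4 three assignments and the last loop test.
    blockCost passCost : ℕ → Fin n → ℕ
    blockCost T u = 3 + deg G u * (8 + T)
    passCost T v = 4 + ∑ (nbrs v) (λ u → 8 + 𝟙 (_≺?_ G u v) * blockCost T u)

    module Bounded {W : ℕ} (n<W : n < W) (entries<W : suc (length entries) < W)
             (block : ∀ v → At (blockStart v) (nbrs v)) where

      Executes : Comm 13 → State 13 n → ℕ → (State 13 n → Set) → Set
      Executes = Exec (encode A) W

      toℕ<W : ∀ (u : Fin n) → toℕ u < W
      toℕ<W u = ℕ.<-trans (toℕ<n u) n<W

      At-<W : ∀ {i us} → At i us → i + length us < W
      At-<W at = ℕ.≤-<-trans (At-≤ at) (ℕ.<-trans (ℕ.n<1+n _) entries<W)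

      At-next<W : ∀ {i u us} → At i (u ∷ us) → i + 1 < W
      At-next<W {i} at = ℕ.≤-<-trans (ℕ.+-monoʳ-≤ i (s≤s z≤n)) (At-<W at)

      start<W : ∀ v → blockStart v < W
      start<W v = ℕ.≤-<-trans (ℕ.m≤m+n _ _) (At-<W (block v))

      end<W : ∀ v → blockStart v + deg G v < W
      end<W v = subst (λ d → blockStart v + d < W) (length-nbrs A v) (At-<W (block v))

      deg<W : ∀ v → deg G v < W
      deg<W v = ℕ.≤-<-trans (ℕ.m≤n+m _ _) (end<W v)

      -- The worst failure takes three tests and a `skip`, hence the 4. Charging `T` only under the
      -- indicator is what makes rejecting a larger neighbour cost a constant, whatever its degree.
      ifPrecedes-exec : ∀ {s a da c T Q} {u v : Fin n} →
        lookup (vars s) a ≡ toℕ u → lookup (vars s) da ≡ deg G u →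
        lookup (vars s) xᵥ ≡ toℕ v → lookup (vars s) xdᵥ ≡ deg G v →
        (_≺_ G u v → Executes c s T Q) → (¬ _≺_ G u v → Q s) →
        Executes (ifPrecedes a da c) s (4 + 𝟙 (_≺?_ G u v) * T) Q
      ifPrecedes-exec {T = T} {u = u} {v} a≡ da≡ v≡ dv≡ here-exec skip-case
        with _≺?_ G u v
      ... | yes u≺v = weaken (ℕ.+-monoʳ-≤ 3 (ℕ.≤-trans (ℕ.n≤1+n T) (ℕ.≤-reflexive (cong suc (sym (ℕ.+-identityʳ T))))))
                        (λ q → q) (run u≺v)
        where
        run : _≺_ G u v → Executes _ _ (3 + T) _
        run (inj₁ du<dv) = weaken (s≤s (ℕ.m≤n+m T 2)) (λ q → q)
          (true-exec (≡.trans (cong₂ _<ᵇ_ da≡ dv≡) (dec-true (deg G u ℕ.<? deg G v) du<dv)) (here-exec u≺v))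
        run (inj₂ (du≡dv , u<v)) =
          false-exec (≡.trans (cong₂ _<ᵇ_ da≡ dv≡) (dec-false (deg G u ℕ.<? deg G v) (ℕ.<-irrefl du≡dv)))
            (true-exec (≡.trans (cong₂ _≡ᵇ_ da≡ dv≡) (dec-true (deg G u ℕ.≟ deg G v) du≡dv))
              (true-exec (≡.trans (cong₂ _<ᵇ_ a≡ v≡) (dec-true (toℕ u ℕ.<? toℕ v) u<v)) (here-exec u≺v)))
      ... | no u⊀v
        with deg G u ℕ.≟ deg G v
      ...   | no du≢dv = weaken (ℕ.n≤1+n 3) (λ q → q)
        (false-exec (≡.trans (cong₂ _<ᵇ_ da≡ dv≡) (dec-false (deg G u ℕ.<? deg G v) (u⊀v ∘ inj₁)))
          (false-exec (≡.trans (cong₂ _≡ᵇ_ da≡ dv≡) (dec-false (deg G u ℕ.≟ deg G v) du≢dv))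
            (skip-exec (skip-case u⊀v))))
      ...   | yes du≡dv =
        false-exec (≡.trans (cong₂ _<ᵇ_ da≡ dv≡) (dec-false (deg G u ℕ.<? deg G v) (u⊀v ∘ inj₁)))
          (true-exec (≡.trans (cong₂ _≡ᵇ_ da≡ dv≡) (dec-true (deg G u ℕ.≟ deg G v) du≡dv))
            (false-exec (≡.trans (cong₂ _<ᵇ_ a≡ v≡)
                (dec-false (toℕ u ℕ.<? toℕ v) (λ u<v → u⊀v (inj₂ (du≡dv , u<v)))))
              (skip-exec (skip-case u⊀v))))

      -- One analysis of the loops serves both clearing and counting. `Ok` is the condition under
      -- which `c` does not get stuck at a hit; `AllOk` asks for it in the memory left by the
      -- earlier hits.
      module Pass (v : Fin n) (c : Comm 13) (T : ℕ)
        (Ok : Fin n → Memory n → Set) (effect : Fin n → Memory n → Memory n)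
        (c-exec : ∀ {p i e u du j f dy σ} (y : Fin n) → Ok y σ →
                  Executes c (state p (toℕ v) (deg G v) i e u du j f (toℕ y) dy σ) T
                    (_≡ state p (toℕ v) (deg G v) i e u du j f (toℕ y) dy (effect y σ)))
        where

        AllOk : List (Fin n) → Memory n → Set
        AllOk []       σ = ⊤
        AllOk (y ∷ ys) σ = Ok y σ × AllOk ys (effect y σ)

        effects : List (Fin n) → Memory n → Memory n
        effects []       σ = σ
        effects (y ∷ ys) σ = effects ys (effect y σ)

        effects-++ : ∀ ys {zs} σ → effects (ys ++ zs) σ ≡ effects zs (effects ys σ)
        effects-++ []       σ = ≡.refl
        effects-++ (y ∷ ys) σ = effects-++ ys (effect y σ)

        AllOk-++ : ∀ ys {zs σ} → AllOk (ys ++ zs) σ → AllOk ys σ × AllOk zs (effects ys σ)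
        AllOk-++ []       ok = tt , ok
        AllOk-++ (y ∷ ys) (ok , oks) with oks₁ , oks₂ ← AllOk-++ ys oks = (ok , oks₁) , oks₂

        AfterBlocks : (p i e u du f : ℕ) → Memory n → State 13 n → Set
        AfterBlocks p i e u du f σ s =
          ∃[ j ] ∃[ y ] ∃[ dy ] s ≡ state p (toℕ v) (deg G v) i e u du j f y dy σ

        -- Looks forward: the remaining hits lead from the present memory to the fixed outcome `σ∞`.
        -- When none remain, the memory is that outcome. `PassInv` has the same shape.
        BlockInv : (p i e u du f : ℕ) → Memory n → List (Fin n) → State 13 n → Set
        BlockInv p i e u du f σ∞ ys s =
          ∃[ j ] ∃[ y ] ∃[ dy ] ∃[ σ ] s ≡ state p (toℕ v) (deg G v) i e u du j f y dy σ ×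
            At j ys × f ≡ j + length ys × AllOk (below A v ys) σ × effects (below A v ys) σ ≡ σ∞

        blockLoop-exec : ∀ {p i e u du f y dy σ} j ys → At j ys → f ≡ j + length ys → AllOk (below A v ys) σ →
          Executes (blockLoop c) (state p (toℕ v) (deg G v) i e u du j f y dy σ) (1 + length ys * (8 + T))
            (AfterBlocks p i e u du f (effects (below A v ys) σ))
        blockLoop-exec {p} {i} {e} {u} {du} {f} {y} {dy} {σ} j ys at f≡ oks =
          weaken (ℕ.≤-reflexive (cong suc (∑-const ys (8 + T))))
            (λ { (j , y , dy , _ , s≡ , _ , _ , _ , ≡.refl) → j , y , dy , s≡ })
            (while-exec (BlockInv p i e u du f (effects (below A v ys) σ)) (λ _ → 7 + T)
              (λ { (j , _ , _ , _ , ≡.refl , _ , f≡ , _) →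
                   dec-false (j ℕ.<? f) (ℕ.<-irrefl (≡.sym (≡.trans f≡ (ℕ.+-identityʳ j)))) })
              (λ { {y} {ys} (j , _ , _ , σ , ≡.refl , at , f≡ , oks , σ≡) →
                   dec-true (j ℕ.<? f) (subst (j <_) (sym f≡) (ℕ.m<m+n j (s≤s z≤n))) , iteration j y ys at f≡ oks σ≡ })
              ys (j , y , dy , σ , ≡.refl , at , f≡ , oks , ≡.refl))
          where
          σ∞ = effects (below A v ys) σ
          iteration : ∀ {y₀ dy₀ σ} j y ys → At j (y ∷ ys) → f ≡ j + suc (length ys) →
            AllOk (below A v (y ∷ ys)) σ → effects (below A v (y ∷ ys)) σ ≡ σ∞ →
            Executes
              (xy ≔ read table (var xⱼ) ⨾ xdy ≔ read degree (var xy) ⨾ ifPrecedes xy xdy c ⨾ xⱼ ≔ var xⱼ ⊕ lit 1)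
              (state p (toℕ v) (deg G v) i e u du j f y₀ dy₀ σ) (7 + T) (BlockInv p i e u du f σ∞ ys)
          iteration {σ = σ} j y ys at f≡ oks σ≡ = weaken bound (λ q → q)
            ((eval-table at ≡.refl , toℕ<W y) ⨾ₑ (eval-degree ≡.refl , deg<W y) ⨾ₑ
             seq-exec (ifPrecedes-exec {u = y} {v} ≡.refl ≡.refl ≡.refl ≡.refl
               (λ y≺v → let ok , oks′ = subst (λ l → AllOk l σ) (accept y≺v) oks in
                 weaken ℕ.≤-refl (λ { ≡.refl → assign-exec add (At-next<W at)
                   (j + 1 , _ , _ , _ , ≡.refl , At-step at , next , oks′ ,
                    subst (λ l → effects l σ ≡ σ∞) (accept y≺v) σ≡) }) (c-exec y ok))
               (λ y⊀v → assign-exec add (At-next<W at)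
                   (j + 1 , _ , _ , _ , ≡.refl , At-step at , next , subst (λ l → AllOk l σ) (reject y⊀v) oks ,
                    subst (λ l → effects l σ ≡ σ∞) (reject y⊀v) σ≡))))
            where
            accept : _≺_ G y v → below A v (y ∷ ys) ≡ y ∷ below A v ys
            accept = filter-accept (λ u → _≺?_ G u v)
            reject : ¬ _≺_ G y v → below A v (y ∷ ys) ≡ below A v ys
            reject = filter-reject (λ u → _≺?_ G u v)
            next : f ≡ j + 1 + length ys
            next = ≡.trans f≡ (sym (ℕ.+-assoc j 1 (length ys)))
            bound : 1 + (1 + (4 + 𝟙 (_≺?_ G y v) * T + 1)) ≤ 7 + T
            bound with _≺?_ G y v
            ... | yes _ = ℕ.≤-reflexive (arith T)
              where
              arith : ∀ T → 1 + (1 + (4 + (T + 0) + 1)) ≡ 7 + T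
              arith = solve-∀
            ... | no _ = ℕ.m≤m+n 7 T

        PassInv : (p e : ℕ) → Memory n → List (Fin n) → State 13 n → Set
        PassInv p e σ∞ us s =
          ∃[ i ] ∃[ u ] ∃[ du ] ∃[ j ] ∃[ f ] ∃[ y ] ∃[ dy ] ∃[ σ ]
            s ≡ state p (toℕ v) (deg G v) i e u du j f y dy σ ×
            At i us × e ≡ i + length us × AllOk (hitsVia v us) σ × effects (hitsVia v us) σ ≡ σ∞

        pass-exec : ∀ {p dv i e u du j f y dy σ} → AllOk (hits A v) σ →
          Executes (pass c) (state p (toℕ v) dv i e u du j f y dy σ) (passCost T v)
            (λ s → ∃[ i ] ∃[ e ] ∃[ u ] ∃[ du ] ∃[ j ] ∃[ f ] ∃[ y ] ∃[ dy ]
               s ≡ state p (toℕ v) (deg G v) i e u du j f y dy (effects (hits A v) σ))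
        pass-exec {p} {σ = σ} oks =
          (eval-degree ≡.refl , deg<W v) ⨾ₑ (eval-start ≡.refl , start<W v) ⨾ₑ (add , end<W v) ⨾ₑ
          weaken ℕ.≤-refl
            (λ { (i , u , du , j , f , y , dy , _ , s≡ , _ , _ , _ , ≡.refl) → i , e , u , du , j , f , y , dy , s≡ })
            (while-exec (PassInv p e σ∞) (λ u → 7 + 𝟙 (_≺?_ G u v) * blockCost T u)
              (λ { (i , _ , _ , _ , _ , _ , _ , _ , ≡.refl , _ , e≡ , _) →
                   dec-false (i ℕ.<? e) (ℕ.<-irrefl (≡.sym (≡.trans e≡ (ℕ.+-identityʳ i)))) })
              (λ { {u} {us} (i , _ , _ , _ , _ , _ , _ , σ , ≡.refl , at , e≡ , oks , σ≡) →
                   dec-true (i ℕ.<? e) (subst (i <_) (sym e≡) (ℕ.m<m+n i (s≤s z≤n))) , iteration i u us at e≡ oks σ≡ })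
              (nbrs v)
              (blockStart v , _ , _ , _ , _ , _ , _ , σ , ≡.refl , block v ,
               cong (blockStart v +_) (sym (length-nbrs A v)) , oks , ≡.refl))
          where
          σ∞ = effects (hits A v) σ
          e = blockStart v + deg G v
          iteration : ∀ {u₀ du₀ j₀ f₀ y₀ dy₀ σ} i u us → At i (u ∷ us) → e ≡ i + suc (length us) →
            AllOk (hitsVia v (u ∷ us)) σ → effects (hitsVia v (u ∷ us)) σ ≡ σ∞ →
            Executes
              (xᵤ ≔ read table (var xᵢ) ⨾ xdᵤ ≔ read degree (var xᵤ) ⨾
               ifPrecedes xᵤ xdᵤ (xⱼ ≔ read start (var xᵤ) ⨾ xf ≔ var xⱼ ⊕ var xdᵤ ⨾ blockLoop c) ⨾
               xᵢ ≔ var xᵢ ⊕ lit 1)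
              (state p (toℕ v) (deg G v) i e u₀ du₀ j₀ f₀ y₀ dy₀ σ)
              (7 + 𝟙 (_≺?_ G u v) * blockCost T u) (PassInv p e σ∞ us)
          iteration {σ = σ} i u us at e≡ oks σ≡ = weaken (ℕ.≤-reflexive (arith (𝟙 (_≺?_ G u v) * blockCost T u))) (λ q → q)
            ((eval-table at ≡.refl , toℕ<W u) ⨾ₑ (eval-degree ≡.refl , deg<W u) ⨾ₑ
             seq-exec (ifPrecedes-exec {u = u} {v} ≡.refl ≡.refl ≡.refl ≡.refl
               (λ u≺v → let oks₁ , oks₂ = AllOk-++ (below A v (nbrs u)) (subst (λ l → AllOk l σ) (accept u≺v) oks) in
                 (eval-start ≡.refl , start<W u) ⨾ₑ (add , end<W u) ⨾ₑ
                 weaken (ℕ.≤-reflexive (cong (λ d → 1 + d * (8 + T)) (length-nbrs A u)))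
                   (λ { (j , y , dy , ≡.refl) → assign-exec add (At-next<W at)
                     (i + 1 , _ , _ , j , _ , y , dy , _ , ≡.refl , At-step at , next , oks₂ ,
                      ≡.trans (sym (effects-++ (below A v (nbrs u)) σ)) (subst (λ l → effects l σ ≡ σ∞) (accept u≺v) σ≡)) })
                   (blockLoop-exec (blockStart u) (nbrs u) (block u) (cong (blockStart u +_) (sym (length-nbrs A u))) oks₁))
               (λ u⊀v → assign-exec add (At-next<W at)
                   (i + 1 , _ , _ , _ , _ , _ , _ , _ , ≡.refl , At-step at , next ,
                    subst (λ l → AllOk l σ) (reject u⊀v) oks ,
                    subst (λ l → effects l σ ≡ σ∞) (reject u⊀v) σ≡))))
            where
            accept : _≺_ G u v → hitsVia v (u ∷ us) ≡ below A v (nbrs u) ++ hitsVia v us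
            accept u≺v = cong (concatMap (below A v ∘ nbrs)) (filter-accept (λ u → _≺?_ G u v) u≺v)
            reject : ¬ _≺_ G u v → hitsVia v (u ∷ us) ≡ hitsVia v us
            reject u⊀v = cong (concatMap (below A v ∘ nbrs)) (filter-reject (λ u → _≺?_ G u v) u⊀v)
            next : e ≡ i + 1 + length us
            next = ≡.trans e≡ (sym (ℕ.+-assoc i 1 (length us)))
            arith : ∀ x → 1 + (1 + (4 + x + 1)) ≡ 7 + x
            arith = solve-∀

  -- Scanning the table

  length-concatMap-≤ : ∀ {A B : Set} (F : A → List B) (c : ℕ) → (∀ x → length (F x) ≤ c) →
                       ∀ xs → length (concatMap F xs) ≤ length xs * c
  length-concatMap-≤ F c F≤c []       = z≤n
  length-concatMap-≤ F c F≤c (x ∷ xs) = subst (_≤ c + length xs * c) (sym (length-++ (F x)))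
    (ℕ.+-mono-≤ (F≤c x) (length-concatMap-≤ F c F≤c xs))

  length-concatMap-take-mono : ∀ {A B : Set} (F : A → List B) {j k} → j ≤ k → ∀ xs →
    length (concatMap F (take j xs)) ≤ length (concatMap F (take k xs))
  length-concatMap-take-mono F z≤n       xs       = z≤n
  length-concatMap-take-mono F (s≤s j≤k) []       = z≤n
  length-concatMap-take-mono F {suc j} {suc k} (s≤s j≤k) (x ∷ xs) =
    subst₂ _≤_ (sym (length-++ (F x))) (sym (length-++ (F x)))
      (ℕ.+-monoʳ-≤ (length (F x)) (length-concatMap-take-mono F j≤k xs))

  -- The share of an arc from `w` to a vertex with neighbour list `us`: everything if `w` is the
  -- first neighbour, nothing otherwise.
  gate : ∀ {n} → List (Fin n) → Fin n → ℕ → ℕ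
  gate []      w g = 0
  gate (u ∷ _) w g = δ u w * g

  module _ {n : ℕ} {G : Graph n} (A : AdjacencyLists G) where
    open Graph G
    open AdjacencyLists A

    private
      prefixLength : ℕ → ℕ
      prefixLength k = length (concatMap nbrs (take k (allFin n)))

    length-nbrs≤n : ∀ v → length (nbrs v) ≤ n
    length-nbrs≤n v = ℕ.≤-trans (ℕ.≤-reflexive (length-nbrs A v))
      (ℕ.≤-trans (length-filter (v ~?_) (allFin n)) (ℕ.≤-reflexive (length-tabulate id)))

    length-entries≤ : length (entries A) ≤ n * n
    length-entries≤ = ℕ.≤-trans (length-concatMap-≤ nbrs n length-nbrs≤n (allFin n))
      (ℕ.≤-reflexive (cong (_* n) (length-tabulate {n = n} id)))

    length-hits≤ : ∀ v → length (hits A v) ≤ n * n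
    length-hits≤ v = ℕ.≤-trans
      (length-concatMap-≤ (below A v ∘ nbrs) n (λ u → ℕ.≤-trans (length-filter _ (nbrs u)) (length-nbrs≤n u))
        (below A v (nbrs v)))
      (ℕ.*-monoˡ-≤ n (ℕ.≤-trans (length-filter _ (nbrs v)) (length-nbrs≤n v)))

    allFin-split : ∀ v → allFin n ≡ take (toℕ v) (allFin n) ++ v ∷ drop (suc (toℕ v)) (allFin n)
    allFin-split v = ≡.trans (sym (take++drop≡id (suc (toℕ v)) (allFin n)))
      (≡.trans (cong (_++ drop (suc (toℕ v)) (allFin n)) (take-suc-tabulate id v))
        (++-assoc (take (toℕ v) (allFin n)) (v ∷ []) (drop (suc (toℕ v)) (allFin n))))

    drop-allFin : ∀ v → drop (toℕ v) (allFin n) ≡ v ∷ drop (suc (toℕ v)) (allFin n)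
    drop-allFin v = ++-cancelˡ (take (toℕ v) (allFin n)) _ _ (≡.trans (take++drop≡id (toℕ v) (allFin n)) (allFin-split v))

    block : ∀ v → At A (blockStart A v) (nbrs v)
    block v = concatMap nbrs (take (toℕ v) (allFin n)) , concatMap nbrs (drop (suc (toℕ v)) (allFin n)) ,
      ≡.trans (cong (concatMap nbrs) (allFin-split v))
        (concatMap-++ nbrs (take (toℕ v) (allFin n)) (v ∷ drop (suc (toℕ v)) (allFin n))) , ≡.refl

    block-end : ∀ v → blockStart A v + deg G v ≡ prefixLength (suc (toℕ v))
    block-end v = begin
      blockStart A v + deg G v
        ≡⟨ cong (blockStart A v +_) (sym (≡.trans (cong length (++-identityʳ (nbrs v))) (length-nbrs A v))) ⟩
      blockStart A v + length (concatMap nbrs (v ∷ []))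
        ≡⟨ length-++ (concatMap nbrs (take (toℕ v) (allFin n))) ⟨
      length (concatMap nbrs (take (toℕ v) (allFin n)) ++ concatMap nbrs (v ∷ []))
        ≡⟨ cong length (concatMap-++ nbrs (take (toℕ v) (allFin n)) (v ∷ [])) ⟨
      length (concatMap nbrs (take (toℕ v) (allFin n) ∷ʳ v))
        ≡⟨ cong (length ∘ concatMap nbrs) (take-suc-tabulate id v) ⟨
      prefixLength (suc (toℕ v)) ∎
      where open ≡-Reasoning

    blocks-disjoint : ∀ {u w} → toℕ u < toℕ w → blockStart A u + deg G u ≤ blockStart A w
    blocks-disjoint {u} u<w = ℕ.≤-trans (ℕ.≤-reflexive (block-end u)) (length-concatMap-take-mono nbrs u<w (allFin n))

    -- Each table entry together with the owner of its block, which the table itself does not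
    -- record.
    arcsFrom : List (Fin n) → List (Fin n × Fin n)
    arcsFrom = concatMap (λ w → map (w ,_) (nbrs w))

    arcs : List (Fin n × Fin n)
    arcs = arcsFrom (allFin n)

    -- Ties a table position to the arcs from there on. A step carries what a visit needs: the
    -- owner's block contains the position, and the entry is one of the owner's neighbours.
    data Walk : ℕ → List (Fin n × Fin n) → Set where
      done : Walk (length (entries A)) []
      step : ∀ {p w v xs} → blockStart A w ≤ p → p < blockStart A w + deg G w → v ∈ nbrs w →
             At A p (v ∷ []) → Walk (p + 1) xs → Walk p ((w , v) ∷ xs)

    walk-block : ∀ {w xs} pre vs → nbrs w ≡ pre ++ vs → Walk (blockStart A w + deg G w) xs →
                 Walk (blockStart A w + length pre) (map (w ,_) vs ++ xs)
    walk-block {w} {xs} pre [] eq walk =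
      subst (λ l → Walk (blockStart A w + l) xs)
        (≡.trans (sym (length-nbrs A w)) (cong length (≡.trans eq (++-identityʳ pre)))) walk
    walk-block {w} {xs} pre (v ∷ vs) eq walk
      with before , after , eq′ , start≡ ← block w =
      step (ℕ.m≤m+n _ _) (ℕ.+-monoʳ-< (blockStart A w) pre<deg)
        (subst (v ∈_) (sym eq) (∈-++⁺ʳ pre (here ≡.refl)))
        (before ++ pre , vs ++ after ,
         (begin
           entries A                           ≡⟨ eq′ ⟩
           before ++ nbrs w ++ after           ≡⟨ cong (λ l → before ++ l ++ after) eq ⟩
           before ++ (pre ++ v ∷ vs) ++ after  ≡⟨ cong (before ++_) (++-assoc pre (v ∷ vs) after) ⟩
           before ++ pre ++ v ∷ vs ++ after    ≡⟨ ++-assoc before pre (v ∷ vs ++ after) ⟨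
           (before ++ pre) ++ v ∷ vs ++ after  ∎) ,
         ≡.trans (length-++ before) (cong (_+ length pre) start≡))
        (subst (λ p → Walk p (map (w ,_) vs ++ xs)) next
          (walk-block (pre ∷ʳ v) vs (≡.trans eq (sym (++-assoc pre (v ∷ []) vs))) walk))
      where
      open ≡-Reasoning
      pre<deg : length pre < deg G w
      pre<deg = subst (length pre <_) (≡.trans (sym (length-++ pre)) (≡.trans (cong length (sym eq)) (length-nbrs A w)))
                  (ℕ.m<m+n (length pre) (s≤s z≤n))
      next : blockStart A w + length (pre ∷ʳ v) ≡ blockStart A w + length pre + 1
      next = ≡.trans (cong (blockStart A w +_) (length-++ pre)) (sym (ℕ.+-assoc (blockStart A w) (length pre) 1))

    -- The walk is built from the end of the table, so the recursion is on the number `d` of blocks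
    -- ahead while `k` grows. Isolated vertices contribute empty blocks.
    walk-suffix : ∀ d k → d + k ≡ n → Walk (prefixLength k) (arcsFrom (drop k (allFin n)))
    walk-suffix zero k ≡.refl = subst₂ (λ xs ys → Walk (length (concatMap nbrs xs)) (arcsFrom ys)) (sym all)
      (sym (++-identityʳ-unique (allFin n)
        (≡.trans (sym (take++drop≡id n (allFin n))) (cong (_++ drop n (allFin n)) all)))) done
      where
      all : take n (allFin n) ≡ allFin n
      all = take-all n (allFin n) (ℕ.≤-reflexive (length-tabulate id))
    walk-suffix (suc d) k eq = subst (λ k → Walk (prefixLength k) (arcsFrom (drop k (allFin n)))) (toℕ-fromℕ< k<n)
      (subst (λ l → Walk (blockStart A w) (arcsFrom l)) (sym (drop-allFin w))
        (subst (λ p → Walk p (arcsFrom (w ∷ drop (suc (toℕ w)) (allFin n)))) (ℕ.+-identityʳ (blockStart A w))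
          (walk-block [] (nbrs w) ≡.refl (subst (λ p → Walk p (arcsFrom (drop (suc (toℕ w)) (allFin n)))) (sym (block-end w))
            (subst (λ k → Walk (prefixLength (suc k)) (arcsFrom (drop (suc k) (allFin n)))) (sym (toℕ-fromℕ< k<n))
              (walk-suffix d (suc k) (≡.trans (ℕ.+-suc d k) eq)))))))
      where
      k<n : k < n
      k<n = subst (k <_) eq (s≤s (ℕ.m≤n+m k d))
      w = fromℕ< k<n

    walk-arcs : Walk 0 arcs
    walk-arcs = walk-suffix n 0 (ℕ.+-identityʳ n)

    ∑-arcs : (f : Fin n × Fin n → ℕ) → ∑ arcs f ≡ ∑ (allFin n) (λ w → ∑ (nbrs w) (λ v → f (w , v)))
    ∑-arcs f = ≡.trans (∑-concatMap (λ w → map (w ,_) (nbrs w)) (allFin n) f)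
      (∑-cong′ (allFin n) λ w → ∑-map (w ,_) (nbrs w) f)

    -- Of the arcs into `v` exactly one is open, the one from its first neighbour; symmetry of
    -- adjacency ensures that this arc exists. An isolated vertex has no arc at all, so its value
    -- must be 0.
    ∑-gate : (g : Fin n → ℕ) → (∀ v → nbrs v ≡ [] → g v ≡ 0) →
             ∑ arcs (λ (w , v) → gate (nbrs v) w (g v)) ≡ ∑ (allFin n) g
    ∑-gate g isolated = begin
      ∑ arcs (λ (w , v) → gate (nbrs v) w (g v))
        ≡⟨ ∑-arcs _ ⟩
      ∑ (allFin n) (λ w → ∑ (nbrs w) (λ v → gate (nbrs v) w (g v)))
        ≡⟨ ∑-cong′ (allFin n) (λ w → ∑-nbrs A w _) ⟩
      ∑ (allFin n) (λ w → ∑ (allFin n) (λ v → 𝟙 (w ~? v) * gate (nbrs v) w (g v)))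
        ≡⟨ ∑-swap (allFin n) (allFin n) _ ⟩
      ∑ (allFin n) (λ v → ∑ (allFin n) (λ w → 𝟙 (w ~? v) * gate (nbrs v) w (g v)))
        ≡⟨ ∑-cong′ (allFin n) (λ v → opened v (nbrs v) ≡.refl) ⟩
      ∑ (allFin n) g ∎
      where
      open ≡-Reasoning
      rearrange : ∀ a b c → a * (b * c) ≡ b * (a * c)
      rearrange = solve-∀
      opened : ∀ v us → nbrs v ≡ us → ∑ (allFin n) (λ w → 𝟙 (w ~? v) * gate us w (g v)) ≡ g v
      opened v [] eq = begin
        ∑ (allFin n) (λ w → 𝟙 (w ~? v) * 0) ≡⟨ ∑-cong′ (allFin n) (λ w → ℕ.*-zeroʳ (𝟙 (w ~? v))) ⟩
        ∑ (allFin n) (λ _ → 0)              ≡⟨ ∑-0 (allFin n) ⟩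
        0                          ≡⟨ isolated v eq ⟨
        g v                        ∎
      opened v (u ∷ us) eq = begin
        ∑ (allFin n) (λ w → 𝟙 (w ~? v) * (δ u w * g v)) ≡⟨ ∑-cong′ (allFin n) (λ w → rearrange (𝟙 (w ~? v)) (δ u w) (g v)) ⟩
        ∑ (allFin n) (λ w → δ u w * (𝟙 (w ~? v) * g v)) ≡⟨ ∑-δ-allFin u _ ⟩
        𝟙 (u ~? v) * g v
          ≡⟨ cong (_* g v) (𝟙-yes (u ~? v) (~-sym (∈-nbrs⁻ A (subst (u ∈_) (sym eq) (here ≡.refl))))) ⟩
        1 * g v                                ≡⟨ ℕ.*-identityˡ (g v) ⟩
        g v                                    ∎

    -- Correctness and cost of the scan

    processCost : Fin n → ℕ
    processCost v = passCost A 1 v + passCost A 4 v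

    -- The 10 covers six assignments, at most two tests and a `skip`, and the increment.
    arcCost : Fin n × Fin n → ℕ
    arcCost (w , v) = 10 + gate (nbrs v) w (processCost v)

    -- What `count` adds to the output over the hits ys when work is initially w: each hit contributes
    -- its initial entry plus the number of its earlier occurrences in ys.
    weight : List (Fin n) → Vec ℕ n → ℕ
    weight ys w = ∑ ys (lookup w) + pairs δ ys

    lookup-increment : ∀ (w : Vec ℕ n) y z → lookup (w [ y ]≔ (lookup w y + 1)) z ≡ lookup w z + δ y z
    lookup-increment w y z with y ≟ᶠ z
    ... | yes ≡.refl = lookup∘update y w _
    ... | no y≢z     = ≡.trans (lookup∘update′ (≢-sym y≢z) w _) (sym (ℕ.+-identityʳ _))

    -- Incrementing the counter of `y` raises the later contributions by `δ y`, which is the row of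
    -- `y` in `pairs δ`.
    weight-∷ : ∀ y ys w → weight (y ∷ ys) w ≡ lookup w y + weight ys (w [ y ]≔ (lookup w y + 1))
    weight-∷ y ys w
      rewrite ∑-cong′ ys (lookup-increment w y) | ∑-+ ys (lookup w) (δ y) =
      rearrange (lookup w y) (∑ ys (lookup w)) (∑ ys (δ y)) (pairs δ ys)
      where
      rearrange : ∀ a b c d → a + b + (c + d) ≡ a + (b + c + d)
      rearrange = solve-∀

    module _ {W : ℕ} (n<W : n < W) (n*n<W : suc (n * n) < W) where

      private
        entries<W : suc (length (entries A)) < W
        entries<W = ℕ.≤-<-trans (s≤s length-entries≤) n*n<W

        open Bounded A n<W entries<W block

        clearHit countHit : Fin n → Memory n → Memory n
        clearHit y (c , t , w) = c , t , w [ y ]≔ 0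
        countHit y (c , t , w) = c + lookup w y , lookup w y + 1 , w [ y ]≔ (lookup w y + 1)

        ResetFits CountFits : Fin n → Memory n → Set
        ResetFits _ _           = ⊤
        CountFits y (c , t , w) = c + lookup w y < W × lookup w y + 1 < W

        reset-exec : ∀ {p v dv i e u du j f dy σ} y → ResetFits y σ →
          Executes reset (state p v dv i e u du j f (toℕ y) dy σ) 1
            (_≡ state p v dv i e u du j f (toℕ y) dy (clearHit y σ))
        reset-exec y _ = store-exec y ≡.refl (ℕ.≤-<-trans z≤n n<W) ≡.refl

        count-exec : ∀ {p v dv i e u du j f dy σ} y → CountFits y σ →
          Executes count (state p v dv i e u du j f (toℕ y) dy σ) 4
            (_≡ state p v dv i e u du j f (toℕ y) dy (countHit y σ))
        count-exec {σ = c , _ , _} y (c<W , w<W) =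
          (read y ≡.refl , ℕ.≤-<-trans (ℕ.m≤n+m _ c) c<W) ⨾ₑ (add , c<W) ⨾ₑ (add , w<W) ⨾ₑ
          store-exec y ≡.refl w<W ≡.refl

        module Reset (v : Fin n) = Pass v reset 1 ResetFits clearHit reset-exec
        module Count (v : Fin n) = Pass v count 4 CountFits countHit count-exec

        reset-ok : ∀ v ys σ → Reset.AllOk v ys σ
        reset-ok v []       σ = tt
        reset-ok v (y ∷ ys) σ = tt , reset-ok v ys _

        -- The alternative closes the induction: an entry is either still to be cleared or already
        -- 0, and clearing moves it from the first case to the second.
        reset-effects : ∀ v ys c t w → ∃[ w′ ] Reset.effects v ys (c , t , w) ≡ (c , t , w′) ×
                          (∀ {z} → z ∈ ys ⊎ lookup w z ≡ 0 → lookup w′ z ≡ 0)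
        reset-effects v []       c t w = w , ≡.refl , λ { (inj₁ ()) ; (inj₂ w≡0) → w≡0 }
        reset-effects v (y ∷ ys) c t w with w′ , eq , zeros ← reset-effects v ys c t (w [ y ]≔ 0) =
          w′ , eq , λ { (inj₁ (here ≡.refl)) → zeros (inj₂ (lookup∘update y w 0))
                      ; (inj₁ (there z∈))    → zeros (inj₁ z∈)
                      ; {z} (inj₂ w≡0)       → zeros (inj₂ (kept z w≡0)) }
          where
          kept : ∀ z → lookup w z ≡ 0 → lookup (w [ y ]≔ 0) z ≡ 0
          kept z w≡0 with z ≟ᶠ y
          ... | yes ≡.refl = lookup∘update y w 0
          ... | no z≢y     = ≡.trans (lookup∘update′ z≢y w 0) w≡0

        -- Two things could overflow. The output is controlled by its final value; a counter grows
        -- by at most 1 per hit, so its value plus the number of hits left never increases.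
        count-effects : ∀ v ys c t w → c + weight ys w < W →
          (∀ {y} → y ∈ ys → lookup w y + length ys < W) →
          Count.AllOk v ys (c , t , w) ×
          (∃[ t′ ] ∃[ w′ ] Count.effects v ys (c , t , w) ≡ (c + weight ys w , t′ , w′))
        count-effects v []       c t w c<W w<W = tt , t , w , cong (_, t , w) (sym (ℕ.+-identityʳ c))
        count-effects v (y ∷ ys) c t w c<W w<W =
          ((ℕ.≤-<-trans (ℕ.m≤m+n _ _) rest<W ,
            ℕ.≤-<-trans (ℕ.+-monoʳ-≤ (lookup w y) (s≤s z≤n)) (w<W (here ≡.refl))) , proj₁ rest) ,
          t′ , w′ , ≡.trans (proj₂ (proj₂ (proj₂ rest))) (cong (λ k → k , t′ , w′) (sym total))
          where
          total : c + weight (y ∷ ys) w ≡ c + lookup w y + weight ys (w [ y ]≔ (lookup w y + 1))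
          total = ≡.trans (cong (c +_) (weight-∷ y ys w)) (sym (ℕ.+-assoc c (lookup w y) _))
          rest<W : c + lookup w y + weight ys (w [ y ]≔ (lookup w y + 1)) < W
          rest<W = subst (_< W) total c<W
          smaller : ∀ z → lookup (w [ y ]≔ (lookup w y + 1)) z + length ys ≤ lookup w z + suc (length ys)
          smaller z = subst₂ _≤_ (≡.trans (sym (ℕ.+-assoc (lookup w z) (δ y z) (length ys)))
                                          (cong (_+ length ys) (sym (lookup-increment w y z)))) ≡.refl
                        (ℕ.+-monoʳ-≤ (lookup w z) (ℕ.+-monoˡ-≤ (length ys) (𝟙≤1 (y ≟ᶠ z))))
          rest = count-effects v ys (c + lookup w y) _ (w [ y ]≔ (lookup w y + 1)) rest<W
                   (λ {z} z∈ → ℕ.≤-<-trans (smaller z) (w<W (there z∈)))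
          t′ = proj₁ (proj₂ rest)
          w′ = proj₁ (proj₂ (proj₂ rest))

      process-exec : ∀ v {p dv i e u du j f y dy c t w} → c + cycles A v < W →
        Executes process (state p (toℕ v) dv i e u du j f y dy (c , t , w)) (processCost v)
          (λ s → ∃[ dv ] ∃[ i ] ∃[ e ] ∃[ u ] ∃[ du ] ∃[ j ] ∃[ f ] ∃[ y ] ∃[ dy ] ∃[ t ] ∃[ w ]
             s ≡ state p (toℕ v) dv i e u du j f y dy (c + cycles A v , t , w))
      process-exec v {c = c} {t} {w} c<W =
        seq-exec (weaken ℕ.≤-refl
          (λ { (i , e , u , du , j , f , y , dy , ≡.refl) → second i e u du j f y dy })
          (Reset.pass-exec v (reset-ok v (hits A v) (c , t , w))))
        where
        reset-result = reset-effects v (hits A v) c t w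
        w₀ = proj₁ reset-result
        zeros : ∀ {z} → z ∈ hits A v → lookup w₀ z ≡ 0
        zeros z∈ = proj₂ (proj₂ reset-result) (inj₁ z∈)
        weight≡ : weight (hits A v) w₀ ≡ cycles A v
        -- Every hit has been cleared, so only the coincidences remain of the weight.
        weight≡ = cong (_+ cycles A v) (≡.trans (∑-cong (hits A v) (λ _ → zeros)) (∑-0 (hits A v)))
        counted = count-effects v (hits A v) c t w₀ (subst (λ k → c + k < W) (sym weight≡) c<W)
          -- Starting from 0, a counter is bounded by the number of hits, at most n squared.
          (λ y∈ → subst (λ k → k + length (hits A v) < W) (sym (zeros y∈))
            (ℕ.≤-<-trans (length-hits≤ v) (ℕ.<-trans (ℕ.n<1+n _) n*n<W)))
        t₂ = proj₁ (proj₂ counted)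
        w₂ = proj₁ (proj₂ (proj₂ counted))
        second : ∀ {p} i e u du j f y dy →
          Executes (pass count)
            (state p (toℕ v) (deg G v) i e u du j f y dy (Reset.effects v (hits A v) (c , t , w)))
            (passCost A 4 v)
            (λ s → ∃[ dv ] ∃[ i ] ∃[ e ] ∃[ u ] ∃[ du ] ∃[ j ] ∃[ f ] ∃[ y ] ∃[ dy ] ∃[ t ] ∃[ w ]
               s ≡ state p (toℕ v) dv i e u du j f y dy (c + cycles A v , t , w))
        second i e u du j f y dy rewrite proj₁ (proj₂ reset-result) =
          weaken ℕ.≤-refl
            (λ { (i , e , u , du , j , f , y , dy , ≡.refl) →
                 deg G v , i , e , u , du , j , f , y , dy , _ , _ ,
                 cong (state _ (toℕ v) (deg G v) i e u du j f y dy)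
                   (≡.trans (proj₂ (proj₂ (proj₂ counted))) (cong (λ k → c + k , t₂ , w₂) weight≡)) })
            (Count.pass-exec v (proj₁ counted))

      Total : List (Fin n × Fin n) → ℕ
      Total xs = ∑ xs (λ (w , v) → gate (nbrs v) w (cycles A v))

      -- The output plus the cycles not yet credited is constant. This gives the result at the end
      -- and a bound on the output at all times.
      OuterInv : ℕ → List (Fin n × Fin n) → State 13 n → Set
      OuterInv c∞ xs s =
        ∃[ p ] ∃[ v ] ∃[ dv ] ∃[ i ] ∃[ e ] ∃[ u ] ∃[ du ] ∃[ j ] ∃[ f ] ∃[ y ] ∃[ dy ] ∃[ c ] ∃[ t ] ∃[ w ]
          s ≡ state p v dv i e u du j f y dy (c , t , w) × Walk p xs × c + Total xs ≡ c∞

      -- Blocks are disjoint intervals, so position `p` of the block of `w` lies in that of the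
      -- first neighbour `u` only if `u` is `w`. That `w` is a neighbour of `v` guarantees a first
      -- neighbour to read.
      visit-exec : ∀ {c∞ p w v xs v₀ dv i e u₀ du j f y dy c t m} → c∞ < W →
        blockStart A w ≤ p → p < blockStart A w + deg G w → w ∈ nbrs v → At A p (v ∷ []) → Walk (p + 1) xs →
        c + (gate (nbrs v) w (cycles A v) + Total xs) ≡ c∞ →
        Executes visit (state p v₀ dv i e u₀ du j f y dy (c , t , m)) (arcCost (w , v)) (OuterInv c∞ xs)
      visit-exec {c∞} {p} {w} {v} {xs} {c = c} c∞<W lo hi w∈ at walk total = opened (nbrs v) ≡.refl w∈
        where
        opened : ∀ us → nbrs v ≡ us → w ∈ us →
          Executes visit (state _ _ _ _ _ _ _ _ _ _ _ _) (arcCost (w , v)) (OuterInv c∞ xs)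
        opened (u ∷ us) eq _ = weaken (ℕ.≤-reflexive cost) id
          ((eval-table A at ≡.refl , toℕ<W v) ⨾ₑ (eval-start A ≡.refl , start<W v) ⨾ₑ
           (eval-table A (subst (At A (blockStart A v)) eq (block v)) ≡.refl , toℕ<W u) ⨾ₑ
           (eval-start A ≡.refl , start<W u) ⨾ₑ (eval-degree A ≡.refl , deg<W u) ⨾ₑ (add , end<W u) ⨾ₑ
           seq-exec (branch (u ≟ᶠ w)))
          where
          cost : 6 + (3 + δ u w * processCost v + 1) ≡ arcCost (w , v)
          cost = ≡.trans (arith (δ u w * processCost v)) (cong (λ us → 10 + gate us w (processCost v)) (sym eq))
            where
            arith : ∀ x → 6 + (3 + x + 1) ≡ 10 + x
            arith = solve-∀
          total′ : c + (δ u w * cycles A v + Total xs) ≡ c∞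
          total′ = subst (λ us → c + (gate us w (cycles A v) + Total xs) ≡ c∞) eq total
          advance : ∀ {v₀ dv i e u₀ du j f y dy c′ t m} → c′ + Total xs ≡ c∞ →
            Executes (xₚ ≔ var xₚ ⊕ lit 1) (state p v₀ dv i e u₀ du j f y dy (c′ , t , m)) 1 (OuterInv c∞ xs)
          advance total″ = assign-exec add (At-next<W at)
            (_ , _ , _ , _ , _ , _ , _ , _ , _ , _ , _ , _ , _ , _ , ≡.refl , walk , total″)
          skipped : u ≢ w → c + Total xs ≡ c∞
          skipped u≢w = subst (λ d → c + (d * cycles A v + Total xs) ≡ c∞) (𝟙-no (u ≟ᶠ w) u≢w) total′
          processed : u ≡ w → c + cycles A v + Total xs ≡ c∞
          processed u≡w = ≡.trans (ℕ.+-assoc c (cycles A v) (Total xs))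
            (≡.trans (cong (λ k → c + (k + Total xs)) (sym (ℕ.+-identityʳ (cycles A v))))
              (subst (λ d → c + (d * cycles A v + Total xs) ≡ c∞) (𝟙-yes (u ≟ᶠ w) u≡w) total′))
          branch : ∀ {dv f y dy j t m} → Dec (u ≡ w) →
            Executes (cond (var xₚ <ᵗ var xᵢ) skip (cond (var xₚ <ᵗ var xₑ) process skip))
              (state p (toℕ v) dv (blockStart A u) (blockStart A u + deg G u) (toℕ u) (deg G u) j f y dy (c , t , m))
              (3 + δ u w * processCost v)
              (λ s → Executes (xₚ ≔ var xₚ ⊕ lit 1) s 1 (OuterInv c∞ xs))
          branch (yes u≡w) = weaken
            (subst (λ d → 2 + processCost v ≤ 3 + d * processCost v) (sym (𝟙-yes (u ≟ᶠ w) u≡w))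
              (ℕ.+-mono-≤ {2} {3} (s≤s (s≤s z≤n)) (ℕ.≤-reflexive (sym (ℕ.+-identityʳ (processCost v))))))
            (λ { (_ , _ , _ , _ , _ , _ , _ , _ , _ , _ , _ , ≡.refl) → advance (processed u≡w) })
            (false-exec (dec-false (p ℕ.<? blockStart A u)
                (ℕ.≤⇒≯ (subst (λ w → blockStart A w ≤ p) (sym u≡w) lo)))
              (true-exec (dec-true (p ℕ.<? blockStart A u + deg G u)
                  (subst (λ w → p < blockStart A w + deg G w) (sym u≡w) hi))
                (process-exec v (ℕ.≤-<-trans (subst (c + cycles A v ≤_) (processed u≡w) (ℕ.m≤m+n _ _)) c∞<W))))
          branch (no u≢w) with ℕ.<-cmp (toℕ u) (toℕ w)
          ... | tri≈ _ u≡w _ = contradiction (toℕ-injective u≡w) u≢w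
          ... | tri< u<w _ _ = weaken (ℕ.m≤m+n 3 _) id
            (false-exec (dec-false (p ℕ.<? blockStart A u)
                (ℕ.≤⇒≯ (ℕ.≤-trans (ℕ.m≤m+n _ _) (ℕ.≤-trans (blocks-disjoint u<w) lo))))
              (false-exec (dec-false (p ℕ.<? blockStart A u + deg G u)
                  (ℕ.≤⇒≯ (ℕ.≤-trans (blocks-disjoint u<w) lo)))
                (skip-exec (advance (skipped u≢w)))))
          ... | tri> _ _ w<u = weaken (ℕ.≤-trans (ℕ.n≤1+n 2) (ℕ.m≤m+n 3 _)) id
            (true-exec (dec-true (p ℕ.<? blockStart A u) (ℕ.<-≤-trans hi (blocks-disjoint w<u)))
              (skip-exec (advance (skipped u≢w))))

      walk-exec : ∀ {c∞} → c∞ < W → ∀ xs {s} → OuterInv c∞ xs s →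
                  Executes (while (var xₚ <ᵗ size) visit) s (1 + ∑ xs (λ a → 1 + arcCost a)) (OuterInv c∞ [])
      walk-exec {c∞} c∞<W = while-exec (OuterInv c∞) arcCost
        (λ { (_ , _ , _ , _ , _ , _ , _ , _ , _ , _ , _ , _ , _ , _ , ≡.refl , done , _) →
             dec-false (length (entries A) ℕ.<? length (map toℕ (entries A)))
               (ℕ.<-irrefl (sym (length-map toℕ (entries A)))) })
        (λ { (p , _ , _ , _ , _ , _ , _ , _ , _ , _ , _ , _ , _ , _ , ≡.refl , step lo hi v∈ at walk , total) →
             dec-true (p ℕ.<? length (map toℕ (entries A)))
               (subst (p <_) (sym (length-map toℕ (entries A))) (ℕ.<-≤-trans (ℕ.m<m+n p (s≤s z≤n)) (At-≤ A at))) ,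
             visit-exec c∞<W lo hi (∈-nbrs⁺ A (~-sym (∈-nbrs⁻ A v∈))) at walk total })

      countCycles-exec : □ G < W → ∀ s →
        Executes countCycles s (3 + ∑ arcs (λ a → 1 + arcCost a)) (λ s′ → lookup (vars s′) xc ≡ □ G)
      -- Splitting the initial vector into its 13 entries gives the starting state the form `state`,
      -- whatever the scalars hold.
      countCycles-exec □<W ⟨ _ ∷ _ ∷ _ ∷ _ ∷ _ ∷ _ ∷ _ ∷ _ ∷ _ ∷ _ ∷ _ ∷ _ ∷ _ ∷ [] , _ ⟩ =
        (val , ℕ.≤-<-trans z≤n n<W) ⨾ₑ (val , ℕ.≤-<-trans z≤n n<W) ⨾ₑ
        weaken ℕ.≤-refl
          (λ { (_ , _ , _ , _ , _ , _ , _ , _ , _ , _ , _ , c , _ , _ , ≡.refl , _ , total) →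
               ≡.trans (sym (ℕ.+-identityʳ c)) total })
          (walk-exec □<W arcs
            (_ , _ , _ , _ , _ , _ , _ , _ , _ , _ , _ , _ , _ , _ , ≡.refl , walk-arcs ,
             ≡.trans (∑-gate (cycles A) isolated) (sym (□-cycles A))))
        where
        isolated : ∀ v → nbrs v ≡ [] → cycles A v ≡ 0
        isolated v eq = cong (λ us → pairs δ (hitsVia A v us)) eq

  -- Bounds on time and word size

  length-cartesianProduct : ∀ {A B : Set} (xs : List A) (ys : List B) →
                            length (cartesianProduct xs ys) ≡ length xs * length ys
  length-cartesianProduct xs ys = begin
    length (cartesianProduct xs ys)              ≡⟨ length-∑ (cartesianProduct xs ys) ⟩
    ∑ (cartesianProduct xs ys) (λ _ → 1)         ≡⟨ ∑-cartesianProduct xs ys (λ _ → 1) ⟩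
    ∑ xs (λ _ → ∑ ys (λ _ → 1))                  ≡⟨ ∑-const xs (∑ ys (λ _ → 1)) ⟩
    length xs * ∑ ys (λ _ → 1)                  ≡⟨ cong (length xs *_) (length-∑ ys) ⟨
    length xs * length ys                       ∎
    where open ≡-Reasoning

  module _ {n : ℕ} (G : Graph n) where
    open Graph G

    -- Exactly one of the two orientations of an edge is increasing, so the adjacency indicator
    -- splits into two edge indicators, and swapping the sums collects both at one edge.
    ∑-edges : (g : Fin n → Fin n → ℕ) →
              ∑ (allFin n) (λ v → ∑ (allFin n) (λ u → 𝟙 (v ~? u) * g v u)) ≡ ∑ (edges G) (λ (u , v) → g u v + g v u)
    ∑-edges g = begin
      ∑ (allFin n) (λ v → ∑ (allFin n) (λ u → 𝟙 (v ~? u) * g v u))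
        ≡⟨ ∑-cong′ (allFin n) (λ v → ∑-cong′ (allFin n) (λ u → orient v u)) ⟩
      ∑ (allFin n) (λ v → ∑ (allFin n) (λ u → e v u * g v u + e u v * g v u))
        ≡⟨ ≡.trans (∑-cong′ (allFin n) (λ v → ∑-+ (allFin n) _ _)) (∑-+ (allFin n) _ _) ⟩
      ∑ (allFin n) (λ v → ∑ (allFin n) (λ u → e v u * g v u)) + ∑ (allFin n) (λ v → ∑ (allFin n) (λ u → e u v * g v u))
        ≡⟨ cong (∑ (allFin n) (λ v → ∑ (allFin n) (λ u → e v u * g v u)) +_)
             (∑-swap (allFin n) (allFin n) (λ v u → e u v * g v u)) ⟩
      ∑ (allFin n) (λ v → ∑ (allFin n) (λ u → e v u * g v u)) + ∑ (allFin n) (λ v → ∑ (allFin n) (λ u → e v u * g u v))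
        ≡⟨ ≡.trans (∑-cong′ (allFin n) (λ v → ∑-+ (allFin n) _ _)) (∑-+ (allFin n) _ _) ⟨
      ∑ (allFin n) (λ v → ∑ (allFin n) (λ u → e v u * g v u + e v u * g u v))
        ≡⟨ ∑-cong′ (allFin n) (λ v → ∑-cong′ (allFin n) (λ u → ℕ.*-distribˡ-+ (e v u) (g v u) (g u v))) ⟨
      ∑ (allFin n) (λ v → ∑ (allFin n) (λ u → e v u * (g v u + g u v)))
        ≡⟨ ∑-cartesianProduct (allFin n) (allFin n) (λ (v , u) → e v u * (g v u + g u v)) ⟨
      ∑ (cartesianProduct (allFin n) (allFin n)) (λ (v , u) → e v u * (g v u + g u v))
        ≡⟨ ∑-filter (isEdge? G) (cartesianProduct (allFin n) (allFin n)) (λ (u , v) → g u v + g v u) ⟨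
      ∑ (edges G) (λ (u , v) → g u v + g v u) ∎
      where
      open ≡-Reasoning
      e : Fin n → Fin n → ℕ
      e u v = 𝟙 (isEdge? G (u , v))
      orient : ∀ v u → 𝟙 (v ~? u) * g v u ≡ e v u * g v u + e u v * g v u
      orient v u = ≡.trans (cong (_* g v u) split) (ℕ.*-distribʳ-+ (g v u) (e v u) (e u v))
        where
        ordered : v ~ u → e v u + e u v ≡ 1
        ordered vu with <ᶠ-cmp v u
        ... | tri< v<u _ u≮v = cong₂ _+_ (𝟙-yes (isEdge? G (v , u)) (v<u , vu)) (𝟙-no (isEdge? G (u , v)) (u≮v ∘ proj₁))
        ... | tri≈ _ v≡u _   = contradiction vu (~-irrefl v≡u)
        ... | tri> v≮u _ u<v = cong₂ _+_ (𝟙-no (isEdge? G (v , u)) (v≮u ∘ proj₁)) (𝟙-yes (isEdge? G (u , v)) (u<v , ~-sym vu))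
        split : 𝟙 (v ~? u) ≡ e v u + e u v
        split = by (v ~? u)
          where
          by : Dec (v ~ u) → 𝟙 (v ~? u) ≡ e v u + e u v
          by (yes vu) = ≡.trans (𝟙-yes (v ~? u) vu) (sym (ordered vu))
          by (no ¬vu) = ≡.trans (𝟙-no (v ~? u) ¬vu)
            (sym (cong₂ _+_ (𝟙-no (isEdge? G (v , u)) (¬vu ∘ proj₂)) (𝟙-no (isEdge? G (u , v)) (¬vu ∘ ~-sym ∘ proj₂))))

    edge-≢ : ∀ {u v} → u ~ v → ¬ u ≡ v
    edge-≢ uv u≡v = ~-irrefl u≡v uv

    deg>0 : ∀ {u v} → u ~ v → 0 < deg G u
    deg>0 {u} {v} uv = ∈-length (∈-filter⁺ (u ~?_) (∈-allFin v) uv)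

    minDegree>0 : ∀ {u v} → u ~ v → 0 < minDegree G (u , v)
    minDegree>0 uv = ℕ.⊓-glb (deg>0 uv) (deg>0 (~-sym uv))

    ∑minDegree : ℕ
    ∑minDegree = ∑ (edges G) (minDegree G)

    -- Scanning the smaller endpoint of an edge is paid for by its minimum degree.
    edge-cost : ∀ (a b : ℕ) {u v} → u ~ v →
      (a + 𝟙 (_≺?_ G u v) * (b * deg G u)) + (a + 𝟙 (_≺?_ G v u) * (b * deg G v)) ≤
      (a + a + b) * minDegree G (u , v)
    edge-cost a b {u} {v} uv = ℕ.≤-trans
      (ℕ.≤-reflexive (rearrange a (𝟙 (_≺?_ G u v) * (b * deg G u)) (𝟙 (_≺?_ G v u) * (b * deg G v))))
      -- The constant part is absorbed because the minimum degree at an edge is positive.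
      (ℕ.≤-trans (ℕ.+-mono-≤ (ℕ.m≤m*n (a + a) (minDegree G (u , v)) {{ℕᵇ.>-nonZero (minDegree>0 uv)}}) scan)
        (ℕ.≤-reflexive (sym (ℕ.*-distribʳ-+ (minDegree G (u , v)) (a + a) b))))
      where
      rearrange : ∀ a x y → (a + x) + (a + y) ≡ a + a + (x + y)
      rearrange = solve-∀
      scan : 𝟙 (_≺?_ G u v) * (b * deg G u) + 𝟙 (_≺?_ G v u) * (b * deg G v) ≤ b * (deg G u ⊓ deg G v)
      scan with ≺-total G (edge-≢ uv)
      ... | inj₁ u≺v rewrite 𝟙-yes (_≺?_ G u v) u≺v | 𝟙-no (_≺?_ G v u) (≺-asym G u≺v)
                           | ℕ.m≤n⇒m⊓n≡m (≺⇒deg≤ G {v = v} u≺v) =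
        ℕ.≤-reflexive (≡.trans (ℕ.+-identityʳ _) (ℕ.+-identityʳ _))
      ... | inj₂ v≺u rewrite 𝟙-yes (_≺?_ G v u) v≺u | 𝟙-no (_≺?_ G u v) (≺-asym G v≺u)
                           | ℕ.m≥n⇒m⊓n≡n (≺⇒deg≤ G {v = u} v≺u) =
        ℕ.≤-reflexive (ℕ.+-identityʳ _)

    □≤ : □ G ≤ n * (n * (n * n))
    □≤ = ℕ.≤-trans (ℕ.≤-reflexive (□-canonical G))
      (ℕ.≤-trans (∑-mono-≤ (quads G) λ q _ → 𝟙≤1 (canonical? G q))
        (ℕ.≤-reflexive (≡.trans (sym (length-∑ (quads G))) length-quads)))
      where
      length-allFin× : ∀ {B : Set} (ys : List B) {k} → length ys ≡ k → length (cartesianProduct (allFin n) ys) ≡ n * k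
      length-allFin× ys {k} eq = ≡.trans (length-cartesianProduct (allFin n) ys)
        (≡.trans (cong (length (allFin n) *_) eq) (cong (_* k) (length-tabulate {n = n} id)))
      length-quads : length (quads G) ≡ n * (n * (n * n))
      length-quads = length-allFin× _ (length-allFin× _ (length-allFin× (allFin n) (length-tabulate {n = n} id)))

  module _ {n : ℕ} {G : Graph n} (A : AdjacencyLists G) where
    open Graph G
    open AdjacencyLists A

    -- For a vertex with neighbours, the constant overhead of process is charged to its edges.
    processCost≤ : ∀ {v} → ¬ nbrs v ≡ [] →
      processCost A v ≤ ∑ (nbrs v) (λ u → 24 + 𝟙 (_≺?_ G u v) * (27 * deg G u))
    processCost≤ {v} nonempty = begin
      (4 + ∑ U f) + (4 + ∑ U g)
        ≡⟨ regroup (∑ U f) (∑ U g) ⟩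
      8 + (∑ U f + ∑ U g)
        ≤⟨ ℕ.+-monoˡ-≤ _ (once U nonempty) ⟩
      ∑ U (λ _ → 8) + (∑ U f + ∑ U g)
        ≡⟨ ≡.trans (∑-+ U (λ _ → 8) (λ u → f u + g u)) (cong (∑ U (λ _ → 8) +_) (∑-+ U f g)) ⟨
      ∑ U (λ u → 8 + (f u + g u))
        ≤⟨ ∑-mono-≤ U (λ u u∈ → pointwise (𝟙 (_≺?_ G u v)) (deg>0 G (~-sym (∈-nbrs⁻ A u∈)))) ⟩
      ∑ U (λ u → 24 + 𝟙 (_≺?_ G u v) * (27 * deg G u)) ∎
      where
      open ℕ.≤-Reasoning
      U = nbrs v
      f g : Fin n → ℕ
      f u = 8 + 𝟙 (_≺?_ G u v) * blockCost A 1 u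
      g u = 8 + 𝟙 (_≺?_ G u v) * blockCost A 4 u
      regroup : ∀ x y → (4 + x) + (4 + y) ≡ 8 + (x + y)
      regroup = solve-∀
      once : ∀ us → ¬ us ≡ [] → 8 ≤ ∑ us (λ _ → 8)
      once []       ne = contradiction ≡.refl ne
      once (_ ∷ us) _  = ℕ.m≤m+n 8 _
      -- Here 24 is three times 8, and the two blocks cost 6 + 21d, which is at most 27d because d
      -- is positive.
      pointwise : ∀ x {d} → 0 < d → 8 + ((8 + x * (3 + d * 9)) + (8 + x * (3 + d * 12))) ≤ 24 + x * (27 * d)
      pointwise x {suc d} _ = ℕ.≤-trans (ℕ.m≤m+n _ (x * (6 * d))) (ℕ.≤-reflexive (arith x d))
        where
        arith : ∀ x d → 8 + ((8 + x * (3 + (1 + d) * 9)) + (8 + x * (3 + (1 + d) * 12))) + x * (6 * d) ≡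
                        24 + x * (27 * (1 + d))
        arith = solve-∀

    private
      vertexCost : ℕ → Fin n → ℕ
      vertexCost a v = ∑ (nbrs v) (λ u → a + 𝟙 (_≺?_ G u v) * (27 * deg G u))

    -- An arc costs 11 for its test and visit, and 24 is charged to it by processing, together 35.
    -- An edge carries two arcs and one scan of factor 27, whence 35 + 35 + 27 = 97.
    totalCost≤ : 3 + ∑ (arcs A) (λ a → 1 + arcCost A a) ≤ 3 + 97 * ∑minDegree G
    totalCost≤ = ℕ.+-monoʳ-≤ 3 (begin
      ∑ (arcs A) (λ (w , v) → 11 + gate (nbrs v) w (processCost A v))
        ≤⟨ ∑-mono-≤ (arcs A) (λ (w , v) _ → ℕ.+-monoʳ-≤ 11 (gate-mono (nbrs v) w processCost≤)) ⟩
      ∑ (arcs A) (λ (w , v) → 11 + gate (nbrs v) w (vertexCost 24 v))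
        ≡⟨ ∑-+ (arcs A) (λ _ → 11) _ ⟩
      ∑ (arcs A) (λ _ → 11) + ∑ (arcs A) (λ (w , v) → gate (nbrs v) w (vertexCost 24 v))
        ≡⟨ cong₂ _+_ (∑-arcs A (λ _ → 11)) (∑-gate A (vertexCost 24) isolated) ⟩
      ∑ (allFin n) (λ v → ∑ (nbrs v) (λ _ → 11)) + ∑ (allFin n) (vertexCost 24)
        ≡⟨ ≡.trans (∑-cong′ (allFin n) (λ v → ∑-+ (nbrs v) (λ _ → 11) _)) (∑-+ (allFin n) _ _) ⟨
      ∑ (allFin n) (vertexCost 35)
        ≡⟨ ∑-cong′ (allFin n) (λ v → ∑-nbrs A v _) ⟩
      ∑ (allFin n) (λ v → ∑ (allFin n) (λ u → 𝟙 (v ~? u) * cost v u))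
        ≡⟨ ∑-edges G cost ⟩
      ∑ (edges G) (λ (u , v) → cost u v + cost v u)
        ≤⟨ ∑-mono-≤ (edges G) (λ (u , v) e∈ → edge-bound
             (proj₂ (proj₂ (∈-filter⁻ (isEdge? G) {xs = cartesianProduct (allFin n) (allFin n)} e∈)))) ⟩
      ∑ (edges G) (λ e → 97 * minDegree G e)
        ≡⟨ ∑-*ˡ (edges G) 97 (minDegree G) ⟩
      97 * ∑minDegree G ∎)
      where
      open ℕ.≤-Reasoning
      cost : Fin n → Fin n → ℕ
      cost v u = 35 + 𝟙 (_≺?_ G u v) * (27 * deg G u)
      isolated : ∀ v → nbrs v ≡ [] → vertexCost 24 v ≡ 0
      isolated v eq rewrite eq = ≡.refl
      gate-mono : ∀ us w {x y} → (¬ us ≡ [] → x ≤ y) → gate us w x ≤ gate us w y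
      gate-mono []       w x≤y = z≤n
      gate-mono (u ∷ us) w x≤y = ℕ.*-monoʳ-≤ (δ u w) (x≤y λ ())
      edge-bound : ∀ {u v} → u ~ v → cost u v + cost v u ≤ 97 * minDegree G (u , v)
      edge-bound {u} {v} uv = ℕ.≤-trans (ℕ.≤-reflexive (ℕ.+-comm (cost u v) (cost v u))) (edge-cost G 35 27 uv)

  module _ (n : ℕ) where

    private
      -- The bounds on indices, counters and output all stay within the fourth power of 2 + n; one
      -- further factor makes them strict.
      base^4<W : (2 + n) ^ 4 < wordBound 5 n
      base^4<W = ℕ.^-monoʳ-< (2 + n) (s≤s (s≤s z≤n)) (ℕ.n<1+n 4)

      base^≤ : ∀ {j} → j ≤ 4 → (2 + n) ^ j ≤ (2 + n) ^ 4
      base^≤ = ℕ.^-monoʳ-≤ (2 + n)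

    order<W : n < wordBound 5 n
    order<W = ℕ.≤-<-trans (ℕ.≤-trans (ℕ.m≤n+m n 2)
      (ℕ.≤-trans (ℕ.≤-reflexive (sym (ℕ.*-identityʳ (2 + n)))) (base^≤ {1} (s≤s z≤n)))) base^4<W

    square<W : suc (n * n) < wordBound 5 n
    square<W = ℕ.≤-<-trans (ℕ.≤-trans (ℕ.m≤m+n _ (3 + 4 * n))
      (ℕ.≤-trans (ℕ.≤-reflexive (arith n)) (base^≤ {2} (s≤s (s≤s z≤n))))) base^4<W
      where
      arith : ∀ n → 1 + n * n + (3 + 4 * n) ≡ (2 + n) * ((2 + n) * 1)
      arith = solve-∀

    fourth<W : n * (n * (n * n)) < wordBound 5 n
    fourth<W = ℕ.≤-<-trans (ℕ.≤-trans (ℕ.≤-reflexive (cong (λ k → n * (n * (n * k))) (sym (ℕ.*-identityʳ n))))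
      (ℕ.^-monoˡ-≤ 4 (ℕ.m≤n+m n 2))) base^4<W

-- From a natural-number cost to the rational bound

open import Data.Rational.Base using (_*_; _⊔_; _≤_; 1ℚ)
import Data.Integer.Base as ℤ
import Data.Integer.Properties as ℤ
open import Data.Nat.Base using () renaming (_≤_ to _≤ℕ_; _*_ to _*ℕ_)
import Data.Rational.Base as ℚ
open import Data.Rational.Base using (toℚᵘ)
import Data.Rational.Properties as ℚ
import Data.Rational.Unnormalised.Base as ℚᵘ
import Data.Rational.Unnormalised.Properties as ℚᵘ

-- Gives access to unnormalised fractions, where comparison is cross multiplication and no common
-- divisor intervenes.
toℚᵘ-/ : ∀ a d → toℚᵘ (ℤ.+ a ℚ./ suc d) ℚᵘ.≃ ℚᵘ.mkℚᵘ (ℤ.+ a) d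
toℚᵘ-/ a d = ℚ.toℚᵘ-fromℚᵘ (ℚᵘ.mkℚᵘ (ℤ.+ a) d)

fromℕ-mono-≤ : ∀ {a b} → a ≤ℕ b → fromℕ a ≤ fromℕ b
fromℕ-mono-≤ {a} {b} a≤b = ℚ.toℚᵘ-cancel-≤ (begin
  toℚᵘ (fromℕ a)       ≃⟨ toℚᵘ-/ a 0 ⟩
  ℚᵘ.mkℚᵘ (ℤ.+ a) 0    ≤⟨ ℚᵘ.*≤* (ℤ.*-monoʳ-≤-nonNeg (ℤ.+ 1) (ℤ.+≤+ a≤b)) ⟩
  ℚᵘ.mkℚᵘ (ℤ.+ b) 0    ≃⟨ toℚᵘ-/ b 0 ⟨
  toℚᵘ (fromℕ b)       ∎)
  where open ℚᵘ.≤-Reasoning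

fromℕ-* : ∀ a b → fromℕ a * fromℕ b ≡ fromℕ (a *ℕ b)
fromℕ-* a b = ℚ.toℚᵘ-injective (begin
  toℚᵘ (fromℕ a * fromℕ b)                  ≈⟨ ℚ.toℚᵘ-homo-* (fromℕ a) (fromℕ b) ⟩
  toℚᵘ (fromℕ a) ℚᵘ.* toℚᵘ (fromℕ b)        ≈⟨ ℚᵘ.*-cong (toℚᵘ-/ a 0) (toℚᵘ-/ b 0) ⟩
  ℚᵘ.mkℚᵘ (ℤ.+ a) 0 ℚᵘ.* ℚᵘ.mkℚᵘ (ℤ.+ b) 0  ≈⟨ ℚᵘ.*≡* (cong (ℤ._* ℤ.+ 1) (sym (ℤ.pos-* a b))) ⟩
  ℚᵘ.mkℚᵘ (ℤ.+ (a *ℕ b)) 0                  ≈⟨ toℚᵘ-/ (a *ℕ b) 0 ⟨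
  toℚᵘ (fromℕ (a *ℕ b))                     ∎)
  where open import Relation.Binary.Reasoning.Setoid ℚᵘ.≃-setoid

*-average : ∀ m s → fromℕ (suc m) * average (suc m) s ≡ fromℕ s
*-average m s = ℚ.toℚᵘ-injective (begin
  toℚᵘ (fromℕ (suc m) * average (suc m) s)            ≈⟨ ℚ.toℚᵘ-homo-* (fromℕ (suc m)) (average (suc m) s) ⟩
  toℚᵘ (fromℕ (suc m)) ℚᵘ.* toℚᵘ (average (suc m) s)  ≈⟨ ℚᵘ.*-cong (toℚᵘ-/ (suc m) 0) (toℚᵘ-/ s m) ⟩
  ℚᵘ.mkℚᵘ (ℤ.+ suc m) 0 ℚᵘ.* ℚᵘ.mkℚᵘ (ℤ.+ s) m        ≈⟨ ℚᵘ.*≡* (≡.trans (ℤ.*-identityʳ _)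
                                                          (≡.trans (ℤ.*-comm (ℤ.+ suc m) (ℤ.+ s))
                                                            (cong (λ k → ℤ.+ s ℤ.* ℤ.+ k) (sym (ℕ.*-identityˡ (suc m)))))) ⟩
  ℚᵘ.mkℚᵘ (ℤ.+ s) 0                                   ≈⟨ toℚᵘ-/ s 0 ⟨
  toℚᵘ (fromℕ s)                                      ∎)
  where open import Relation.Binary.Reasoning.Setoid ℚᵘ.≃-setoid

-- For `s` = 0 the cost is at most 3 and the maximum with 1 covers it; otherwise 3 is at most `3 s`,
-- which gives 100 from 97. The first hypothesis excludes an empty average with a positive sum,
-- which the convention 0 would lose.
cost≤average : ∀ t m s → (m ≡ 0 → s ≡ 0) → t ≤ℕ 3 + 97 *ℕ s →
               fromℕ t ≤ fromℕ 100 * (fromℕ m * average m s ⊔ 1ℚ)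
cost≤average t m zero _ t≤ = begin
  fromℕ t          ≤⟨ fromℕ-mono-≤ (ℕ.≤-trans t≤ (ℕ.m≤m+n 3 97)) ⟩
  fromℕ 100        ≡⟨ ℚ.*-identityʳ (fromℕ 100) ⟨
  fromℕ 100 * 1ℚ   ≤⟨ ℚ.*-monoˡ-≤-nonNeg (fromℕ 100) (ℚ.p≤q⊔p (fromℕ m * average m zero) 1ℚ) ⟩
  fromℕ 100 * (fromℕ m * average m zero ⊔ 1ℚ) ∎
  where open ℚ.≤-Reasoning
cost≤average t zero (suc s) m≡0⇒ _ = contradiction (m≡0⇒ ≡.refl) λ ()
cost≤average t (suc m) (suc s) _ t≤ = begin
  fromℕ t                                          ≤⟨ fromℕ-mono-≤ (ℕ.≤-trans t≤ bound) ⟩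
  fromℕ (100 *ℕ suc s)                             ≡⟨ fromℕ-* 100 (suc s) ⟨
  fromℕ 100 * fromℕ (suc s)                        ≡⟨ cong (fromℕ 100 *_) (*-average m (suc s)) ⟨
  fromℕ 100 * (fromℕ (suc m) * average (suc m) (suc s))
    ≤⟨ ℚ.*-monoˡ-≤-nonNeg (fromℕ 100) (ℚ.p≤p⊔q (fromℕ (suc m) * average (suc m) (suc s)) 1ℚ) ⟩
  fromℕ 100 * (fromℕ (suc m) * average (suc m) (suc s) ⊔ 1ℚ) ∎
  where
  open ℚ.≤-Reasoning
  bound : 3 + 97 *ℕ suc s ≤ℕ 100 *ℕ suc s
  bound = ℕ.≤-trans (ℕ.m≤m+n _ (3 *ℕ s)) (ℕ.≤-reflexive (arith s))
    where
    arith : ∀ s → 3 + 97 *ℕ (1 + s) + 3 *ℕ s ≡ 100 *ℕ (1 + s)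
    arith = solve-∀

theorem1 : Σ[ P ∈ Program ] Σ[ c ∈ ℕ ] Σ[ k ∈ ℕ ]
    ((n : ℕ) (G : Graph n) (A : AdjacencyLists G) →
    (s : State (Program.scalars P) n) → Fits (wordBound k n) s →
    ∃[ t ] ∃[ s′ ]
    Run (encode A) (wordBound k n) (Program.body P) s t s′ ×
    lookup (vars s′) (Program.output P) ≡ □ G ×
    fromℕ t ≤ fromℕ c * (fromℕ (∣E∣ G) * δ̄ G ⊔ 1ℚ))
theorem1 = record { scalars = 13 ; output = xc ; body = countCycles } , 100 , 5 , λ n G A s _ →
  let t , s′ , run , t≤ , output≡ =
        countCycles-exec A (order<W n) (square<W n) (ℕ.≤-<-trans (□≤ G) (fourth<W n)) s
  in t , s′ , run , output≡ ,
     cost≤average t (∣E∣ G) (∑minDegree G) (edgeless (edges G)) (ℕ.≤-trans t≤ (totalCost≤ A))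
  where
  edgeless : ∀ {E : Set} {f : E → ℕ} (es : List E) → length es ≡ 0 → ∑ es f ≡ 0
  edgeless [] _ = ≡.refl
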